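{- For all integers $k\geq 1$ and $n\geq 2k+1$, the bipartite Kneser graph $H(n,k)$ has a Hamilton cycle.
   Context: For integers $k\geq 1$ and $n\geq 2k+1$, the bipartite Kneser graph $H(n,k)$ is the graph whose vertices are all $k$-element subsets and all $(n-k)$-element subsets of $[n]=\{1,2,\ldots,n\}$, with an edge between two vertices whenever one of the two sets is a subset of the other. -}

module Defs where

open import Data.Nat using (ℕ; _∸_; _≤_)
open import Data.Fin.Subset using (Subset; _⊆_; ∣_∣)
open import Data.Product using (Σ; _×_)
open import Data.Sum using (_⊎_)
open import Data.List using (List; []; _∷_; length)
open import Data.List.Relation.Unary.Unique.Propositional using (Unique)
open import Data.List.Membership.Propositional using (_∈_)
open import Relation.Binary.PropositionalEquality using (_≡_)

IsVertex : (n k : ℕ) → Subset n → Set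
IsVertex n k s = ∣ s ∣ ≡ k ⊎ ∣ s ∣ ≡ n ∸ k

-- Edge relation of H(n,k): one set is a subset of the other
-- (for n ≥ 2k+1 the two levels are disjoint, so no loops arise between
--  distinct vertices; the Hamilton cycle below uses distinct vertices).
Adj : {n : ℕ} → Subset n → Subset n → Set
Adj s t = s ⊆ t ⊎ t ⊆ s

data Path {n : ℕ} : List (Subset n) → Set where
  path-nil  : Path []
  path-one  : ∀ s → Path (s ∷ [])
  path-cons : ∀ s t {c} → Adj s t → Path (t ∷ c) → Path (s ∷ t ∷ c)

last : {A : Set} → A → List A → A
last a [] = a
last a (b ∷ c) = last b c

record HamiltonCycle (n k : ℕ) : Set where
  field
    v₀       : Subset n
    rest     : List (Subset n)
    vertices : ∀ s → s ∈ (v₀ ∷ rest) → IsVertex n k s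
    distinct : Unique (v₀ ∷ rest)
    spanning : ∀ s → IsVertex n k s → s ∈ (v₀ ∷ rest)
    long     : 2 ≤ length rest
    path     : Path (v₀ ∷ rest)
    closing  : Adj (last v₀ rest) v₀

{-# OPTIONS --safe #-}
-- The case n = 2k + 1 (the middle levels theorem) follows Gregor, Mütze and Nummenpalo. Every word with as
-- many ones as zeros, or two more, lies on exactly one of the paths P t, where t runs through the plane forests
-- with k edges, coded by Dyck words. The paths, the complements of their reversals, and the edges between the
-- two halves of the cube form disjoint cycles, and running along a cycle rotates the plane tree. An exchange
-- along a 6-cycle swaps the ends of two paths whose trees differ by moving one leaf; since these moves connect
-- all plane trees, suitable exchanges merge all cycles into one.
--
-- For n > 2k + 1 the induction of Mütze and Su applies: the k-sets are arranged cyclically, and consecutive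
-- k-sets lie in a common (k+1)-set from which a chain ascends to an (n-k)-set, the chains being disjoint and
-- their tops exhausting all (n-k)-sets. Such arrangements for (n, k+1) and (n, k) combine to one for (n+1, k+1),
-- and skipping to the top of every chain turns an arrangement into a Hamilton cycle.
module Submission where

open import Data.Bool using (Bool; true; false; not; if_then_else_)
open import Data.Bool.Properties using (not-involutive)
open import Data.Empty using (⊥; ⊥-elim)
open import Data.Fin using (toℕ)
open import Data.Fin.Properties using (pigeonhole)
open import Data.Fin.Subset using (Subset; _⊆_; ∣_∣)
open import Data.Fin.Subset.Properties using (⊆-refl; ⊆-trans; ⊆-reflexive; out⊆; s⊆s; ∣p∣≤n)
open import Data.List using (List; []; _∷_; _++_; map; reverse; length; lookup; concatMap; iterate; cartesianProduct; cartesianProductWith)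
open import Data.List.Membership.Propositional using (_∈_; _∉_; find; lose)
open import Data.List.Membership.Propositional.Properties using (∈-map⁺; ∈-map⁻; ∈-++⁺ˡ; ∈-++⁺ʳ; ∈-++⁻; ∈-concatMap⁺; ∈-concatMap⁻; ∈-cartesianProduct⁺; ∈-cartesianProductWith⁺)
open import Data.List.Properties using (++-assoc; ++-identityʳ; map-++; map-∘; map-id; map-cong; reverse-++; reverse-involutive; reverse-injective; reverse-map; unfold-reverse; length-++; length-reverse; length-map; ∷-injectiveʳ)
open import Data.List.Relation.Binary.Permutation.Propositional using (_↭_; ↭-refl; ↭-sym; ↭-trans; ↭-prep; ↭-swap; ↭-reflexive; ↭⇒↭ₛ)
open import Data.List.Relation.Binary.Permutation.Propositional.Properties using (∈-resp-↭; ↭-reverse; ∷↭∷ʳ; map⁺; shift) renaming (++⁺ to ++⁺-↭; ++⁺ˡ to ++⁺ˡ-↭; ++⁺ʳ to ++⁺ʳ-↭; ++-comm to ++-comm-↭; ++-assoc to ++-assoc-↭)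
open import Data.List.Relation.Unary.All as All using (All; []; _∷_)
open import Data.List.Relation.Unary.AllPairs using ([]; _∷_)
open import Data.List.Relation.Unary.Any using (here; there; index)
open import Data.List.Relation.Unary.Any.Properties using (lookup-index)
open import Data.List.Relation.Unary.Unique.Propositional using (Unique)
open import Data.Nat using (ℕ; zero; suc; pred; _+_; _*_; _∸_; _%_; _/_; _≤_; _<_; _≤?_; z≤n; s≤s)
open import Data.Nat.DivMod using (m≡m%n+[m/n]*n; m%n<n)
open import Data.Nat.Properties
open import Data.Product using (∃; ∃₂; _×_; _,_; proj₁; proj₂)
open import Data.Sum using (_⊎_; inj₁; inj₂; [_,_]′; swap)
open import Data.Vec using (Vec; []; _∷_; toList)
open import Data.Vec.Properties using (length-toList)
open import Defs
open import Function using (_∘_)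
open import Relation.Binary.Definitions using (DecidableEquality)
open import Relation.Binary.PropositionalEquality
open import Relation.Nullary using (¬_; Dec; yes; no)
open import Relation.Nullary.Decidable using (map′; _×-dec_)
import Data.Bool.Properties as Bool
import Data.List.Relation.Binary.Permutation.Setoid.Properties as PermS
import Data.List.Relation.Unary.Unique.Propositional.Properties as Uniq
import Data.Vec.Properties as Vec

-- Binary words and plane trees

-- Two obstacles shape the proof. Exchanges could overlap, or split a cycle instead of merging two.
-- Here the pairs `deep w v`, `flat w v` are disjoint for different `w`, `v`, so any set of
-- exchanges can be made at once. A pair is exchanged only if its two trees lie on different cycles
-- at that moment; the successor map is then composed with a transposition across two orbits, which
-- always merges them. A pair that already lies on one cycle is left alone, so no spanning tree of
-- moves has to be chosen. The induction for larger n cuts two cyclic arrangements open and glues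
-- them, so it must know where each can be cut. Mere existence of a cycle is too weak: the first
-- set, the last set and the chain between them are prescribed by explicit words, and the middle
-- levels cycle has to pass through them. It does because its tour starts at the tree `comb`, and
-- injectivity of the rotation fixes how a tour returning there ends, whichever exchanges were made.

pattern 𝟎 = false
pattern 𝟏 = true

Word : Set
Word = List Bool

ones zeros : Word → ℕ
ones []      = 0
ones (𝟏 ∷ w) = suc (ones w)
ones (𝟎 ∷ w) = ones w
zeros []      = 0
zeros (𝟏 ∷ w) = zeros w
zeros (𝟎 ∷ w) = suc (zeros w)

ones-++ : ∀ v w → ones (v ++ w) ≡ ones v + ones w
ones-++ []      w = refl
ones-++ (𝟏 ∷ v) w = cong suc (ones-++ v w)
ones-++ (𝟎 ∷ v) w = ones-++ v w

zeros-++ : ∀ v w → zeros (v ++ w) ≡ zeros v + zeros w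
zeros-++ []      w = refl
zeros-++ (𝟏 ∷ v) w = zeros-++ v w
zeros-++ (𝟎 ∷ v) w = cong suc (zeros-++ v w)

ones-reverse : ∀ w → ones (reverse w) ≡ ones w
ones-reverse []      = refl
ones-reverse (b ∷ w) rewrite unfold-reverse b w | ones-++ (reverse w) (b ∷ []) | ones-reverse w with b
... | 𝟏 = +-comm (ones w) 1
... | 𝟎 = +-identityʳ (ones w)

zeros-reverse : ∀ w → zeros (reverse w) ≡ zeros w
zeros-reverse []      = refl
zeros-reverse (b ∷ w) rewrite unfold-reverse b w | zeros-++ (reverse w) (b ∷ []) | zeros-reverse w with b
... | 𝟎 = +-comm (zeros w) 1
... | 𝟏 = +-identityʳ (zeros w)

ones-not : ∀ w → ones (map not w) ≡ zeros w
ones-not []      = refl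
ones-not (𝟏 ∷ w) = ones-not w
ones-not (𝟎 ∷ w) = cong suc (ones-not w)

zeros-not : ∀ w → zeros (map not w) ≡ ones w
zeros-not []      = refl
zeros-not (𝟏 ∷ w) = cong suc (zeros-not w)
zeros-not (𝟎 ∷ w) = zeros-not w

length-ones-zeros : ∀ w → length w ≡ ones w + zeros w
length-ones-zeros []      = refl
length-ones-zeros (𝟏 ∷ w) = cong suc (length-ones-zeros w)
length-ones-zeros (𝟎 ∷ w) = trans (cong suc (length-ones-zeros w)) (sym (+-suc (ones w) (zeros w)))

map-not-involutive : ∀ w → map not (map not w) ≡ w
map-not-involutive w = trans (sym (map-∘ w)) (trans (map-cong not-involutive w) (map-id w))

-- Reflects a lattice path from left to right; reversal alone would exchange up-steps and
-- down-steps. On Dyck words this is `mirror`.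
star : Word → Word
star w = map not (reverse w)

star-++ : ∀ v w → star (v ++ w) ≡ star w ++ star v
star-++ v w = trans (cong (map not) (reverse-++ v w)) (map-++ not (reverse w) (reverse v))

star-involutive : ∀ w → star (star w) ≡ w
star-involutive w = trans (cong (map not) (sym (reverse-map not (reverse w))))
  (trans (map-not-involutive _) (reverse-involutive w))

ones-star : ∀ w → ones (star w) ≡ zeros w
ones-star w = trans (ones-not (reverse w)) (zeros-reverse w)

zeros-star : ∀ w → zeros (star w) ≡ ones w
zeros-star w = trans (zeros-not (reverse w)) (ones-reverse w)

-- node a b is the forest whose first tree has the forest a of children, followed by the forest b; adding a
-- root turns a forest into a plane tree.
data Forest : Set where
  ε    : Forest
  node : Forest → Forest → Forest

size : Forest → ℕ
size ε          = 0
size (node a b) = suc (size a + size b)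

word : Forest → Word
word ε          = []
word (node a b) = 𝟏 ∷ word a ++ 𝟎 ∷ word b

infixr 5 _⋆_

_⋆_ : Forest → Forest → Forest
ε        ⋆ c = c
node a b ⋆ c = node a (b ⋆ c)

⋆-identityʳ : ∀ a → a ⋆ ε ≡ a
⋆-identityʳ ε          = refl
⋆-identityʳ (node a b) = cong (node a) (⋆-identityʳ b)

⋆-assoc : ∀ a b c → (a ⋆ b) ⋆ c ≡ a ⋆ b ⋆ c
⋆-assoc ε          b c = refl
⋆-assoc (node x y) b c = cong (node x) (⋆-assoc y b c)

size-⋆ : ∀ a b → size (a ⋆ b) ≡ size a + size b
size-⋆ ε          b = refl
size-⋆ (node x y) b = cong suc (trans (cong (size x +_) (size-⋆ y b)) (sym (+-assoc (size x) (size y) (size b))))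

word-⋆ : ∀ a b → word (a ⋆ b) ≡ word a ++ word b
word-⋆ ε          b = refl
word-⋆ (node x y) b = cong (𝟏 ∷_) (trans (cong (λ s → word x ++ 𝟎 ∷ s) (word-⋆ y b))
  (sym (++-assoc (word x) (𝟎 ∷ word y) (word b))))

mirror : Forest → Forest
mirror ε          = ε
mirror (node a b) = mirror b ⋆ node (mirror a) ε

size-mirror : ∀ a → size (mirror a) ≡ size a
size-mirror ε          = refl
size-mirror (node a b) rewrite size-⋆ (mirror b) (node (mirror a) ε) | size-mirror a | size-mirror b
  | +-identityʳ (size a) | +-suc (size b) (size a) = cong suc (+-comm (size b) (size a))

word-mirror : ∀ a → word (mirror a) ≡ star (word a)
word-mirror ε = refl
word-mirror (node a b) = begin
  word (mirror b ⋆ node (mirror a) ε)                  ≡⟨ word-⋆ (mirror b) _ ⟩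
  word (mirror b) ++ 𝟏 ∷ word (mirror a) ++ 𝟎 ∷ []     ≡⟨ cong₂ (λ x y → x ++ 𝟏 ∷ y ++ 𝟎 ∷ []) (word-mirror b) (word-mirror a) ⟩
  star (word b) ++ 𝟏 ∷ star (word a) ++ 𝟎 ∷ []         ≡⟨ ++-assoc (star (word b)) (𝟏 ∷ []) _ ⟨
  (star (word b) ++ 𝟏 ∷ []) ++ star (word a) ++ 𝟎 ∷ [] ≡⟨ cong₂ _++_ (star-++ (𝟎 ∷ []) (word b)) (star-++ (𝟏 ∷ []) (word a)) ⟨
  star (𝟎 ∷ word b) ++ star (𝟏 ∷ word a)               ≡⟨ star-++ (𝟏 ∷ word a) (𝟎 ∷ word b) ⟨
  star (word (node a b)) ∎
  where open ≡-Reasoning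

ones-word : ∀ a → ones (word a) ≡ size a
ones-word ε          = refl
ones-word (node a b) rewrite ones-++ (word a) (𝟎 ∷ word b) | ones-word a | ones-word b = refl

zeros-word : ∀ a → zeros (word a) ≡ size a
zeros-word ε          = refl
zeros-word (node a b) rewrite zeros-++ (word a) (𝟎 ∷ word b) | zeros-word a | zeros-word b = +-suc (size a) (size b)

-- Unique readability

-- A Dyck word never goes below its starting height, so the displayed 0 is the first letter that
-- does, and it stands at the same place in both words.
word-cancel : ∀ a b {r s} → word a ++ 𝟎 ∷ r ≡ word b ++ 𝟎 ∷ s → a ≡ b × r ≡ s
word-cancel ε ε eq = refl , ∷-injectiveʳ eq
word-cancel ε (node _ _) ()
word-cancel (node _ _) ε ()
word-cancel (node a a₁) (node b b₁) {r} {s} eq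
  with word-cancel a b (trans (sym (++-assoc (word a) (𝟎 ∷ word a₁) (𝟎 ∷ r)))
         (trans (∷-injectiveʳ eq) (++-assoc (word b) (𝟎 ∷ word b₁) (𝟎 ∷ s))))
... | refl , eq₁ with word-cancel a₁ b₁ eq₁
... | refl , eq₂ = refl , eq₂

word-injective : ∀ a b → word a ≡ word b → a ≡ b
word-injective a b eq = proj₁ (word-cancel a b (cong (_++ 𝟎 ∷ []) eq))

word-nonneg : ∀ t a {r} → word t ≢ word a ++ 𝟎 ∷ r
word-nonneg ε ε ()
word-nonneg ε (node _ _) ()
word-nonneg (node _ _) ε ()
word-nonneg (node t t₁) (node a a₁) {r} eq
  with word-cancel t a (trans (∷-injectiveʳ eq) (++-assoc (word a) (𝟎 ∷ word a₁) (𝟎 ∷ r)))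
... | refl , eq₁ = word-nonneg t₁ a₁ eq₁

mirror-involutive : ∀ a → mirror (mirror a) ≡ a
mirror-involutive a = word-injective _ a
  (trans (word-mirror (mirror a)) (trans (cong star (word-mirror a)) (star-involutive (word a))))

-- With 1 as up-step and 0 as down-step, a path goes below its start, or stays above and returns to
-- it, or stays above and ends higher. Of the last case only the excess of ones is kept, since it
-- serves only to be refuted by a count.
data LeftFactor (w : Word) : Set where
  dips     : ∀ a r → w ≡ word a ++ 𝟎 ∷ r → LeftFactor w
  dyck     : ∀ t → w ≡ word t → LeftFactor w
  positive : zeros w < ones w → LeftFactor w

length-dip : ∀ a r {n} → length (word a ++ 𝟎 ∷ r) ≤ n → suc (length r) ≤ n
length-dip a r p = ≤-trans (≤-trans (m≤n+m _ (length (word a))) (≤-reflexive (sym (length-++ (word a))))) p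

-- After a dip the recursion restarts on the rest `r`, which is no structural subterm; hence the
-- bound on the length.
left-factor-bounded : ∀ n w → length w ≤ n → LeftFactor w
left-factor-bounded n       []      p = dyck ε refl
left-factor-bounded n       (𝟎 ∷ r) p = dips ε r refl
left-factor-bounded (suc n) (𝟏 ∷ w) (s≤s p) with left-factor-bounded n w p
... | dyck t refl = positive (s≤s (≤-reflexive (trans (zeros-word t) (sym (ones-word t)))))
... | positive q  = positive (m≤n⇒m≤1+n q)
... | dips a r refl with left-factor-bounded n r (≤-trans (n≤1+n _) (length-dip a r p))
...   | dips b s refl = dips (node a b) s (cong (𝟏 ∷_) (sym (++-assoc (word a) (𝟎 ∷ word b) (𝟎 ∷ s))))
...   | dyck t refl   = dyck (node a t) refl
...   | positive q    = positive (subst₂ _<_ (sym (zeros-++ (word a) (𝟎 ∷ r))) (sym (cong suc (ones-++ (word a) (𝟎 ∷ r))))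
          (subst (_≤ suc (ones (word a) + ones r)) (cong suc (sym (+-suc (zeros (word a)) (zeros r))))
            (s≤s (subst (λ m → suc (zeros (word a) + zeros r) ≤ m + ones r) (trans (zeros-word a) (sym (ones-word a)))
              (+-monoʳ-< (zeros (word a)) q)))))

left-factor : ∀ w → LeftFactor w
left-factor w = left-factor-bounded (length w) w ≤-refl

-- Covering words by paths

-- A word with as many ones as zeros, or two more, is a Dyck word or splits uniquely as m 1 v with v Dyck; here
-- the numbers of ones and zeros in m differ by one, and m is either 1 t, or 0 w with w of the first kind, or
-- 1 a 0 m′, where t and a are Dyck. P and K list the words of both kinds according to this recursion.

P K Q D : Forest → List Word
P t = word t ∷ Q t
K t = (𝟏 ∷ word t) ∷ map (𝟎 ∷_) (P t) ++ D t
Q ε          = []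
Q (node a b) = map (λ m → m ++ 𝟏 ∷ word b) (K a)
D ε          = []
D (node a b) = map (λ m → 𝟏 ∷ word a ++ 𝟎 ∷ m) (K b)

Balanced Odd : Word → Set
Balanced w = ones w ≡ zeros w ⊎ ones w ≡ 2 + zeros w
Odd      w = zeros w ≡ suc (ones w) ⊎ ones w ≡ suc (zeros w)

shift-cancel : ∀ s {x y} → x + suc s ≡ y + s → suc x ≡ y
shift-cancel s {x} {y} eq = +-cancelʳ-≡ s (suc x) y (trans (sym (+-suc x s)) eq)

odd-prefix : ∀ m b → Balanced (m ++ 𝟏 ∷ word b) → Odd m
odd-prefix m b h rewrite ones-++ m (𝟏 ∷ word b) | zeros-++ m (𝟏 ∷ word b) | ones-word b | zeros-word b with h
... | inj₁ eq = inj₁ (sym (shift-cancel (size b) eq))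
... | inj₂ eq = inj₂ (suc-injective (shift-cancel (size b) eq))

odd-suffix : ∀ a m → Odd (𝟏 ∷ word a ++ 𝟎 ∷ m) → Odd m
odd-suffix a m h rewrite ones-++ (word a) (𝟎 ∷ m) | zeros-++ (word a) (𝟎 ∷ m) | ones-word a | zeros-word a
  | +-suc (size a) (zeros m) with h
... | inj₁ eq = inj₁ (+-cancelˡ-≡ (size a) _ _ (trans (suc-injective eq) (sym (+-suc (size a) (ones m)))))
... | inj₂ eq = inj₂ (+-cancelˡ-≡ (size a) _ _ (trans (suc-injective eq) (sym (+-suc (size a) (zeros m)))))

star-dip : ∀ w a r → star w ≡ word a ++ 𝟎 ∷ r → w ≡ star r ++ 𝟏 ∷ word (mirror a)
star-dip w a r eq = begin
  w                                       ≡⟨ star-involutive w ⟨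
  star (star w)                           ≡⟨ cong star eq ⟩
  star (word a ++ 𝟎 ∷ r)                  ≡⟨ star-++ (word a) (𝟎 ∷ r) ⟩
  star (𝟎 ∷ r) ++ star (word a)           ≡⟨ cong₂ _++_ (star-++ (𝟎 ∷ []) r) (sym (word-mirror a)) ⟩
  (star r ++ 𝟏 ∷ []) ++ word (mirror a)   ≡⟨ ++-assoc (star r) (𝟏 ∷ []) _ ⟩
  star r ++ 𝟏 ∷ word (mirror a)           ∎
  where open ≡-Reasoning

∈K-first : ∀ t → 𝟏 ∷ word t ∈ K t
∈K-first t = here refl

∈K-inner : ∀ t {w} → w ∈ P t → 𝟎 ∷ w ∈ K t
∈K-inner t w∈P = there (∈-++⁺ˡ (∈-map⁺ (𝟎 ∷_) w∈P))

∈K-outer : ∀ a b {m} → m ∈ K b → 𝟏 ∷ word a ++ 𝟎 ∷ m ∈ K (node a b)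
∈K-outer a b m∈K = there (∈-++⁺ʳ (map (𝟎 ∷_) (P (node a b))) (∈-map⁺ _ m∈K))

mutual
  -- The split m 1 v has its Dyck word at the end. Under `star` it becomes a Dyck prefix followed by
  -- 0, which `left-factor` finds.
  P-covers-bounded : ∀ n w → length w ≤ n → Balanced w → ∃ λ t → w ∈ P t
  P-covers-bounded n w p h with left-factor (star w)
  ... | dyck t eq = mirror t , here (trans (sym (star-involutive w)) (trans (cong star eq) (sym (word-mirror t))))
  ... | positive q = ⊥-elim (nonneg h)
    where
    q′ : ones w < zeros w
    q′ = subst₂ _<_ (zeros-star w) (ones-star w) q
    nonneg : Balanced w → ⊥
    nonneg (inj₁ eq) = <⇒≢ q′ eq
    nonneg (inj₂ eq) = <⇒≱ q′ (≤-trans (m≤n+m _ 2) (≤-reflexive (sym eq)))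
  ... | dips a r eq with star-dip w a r eq
  ...   | refl with ≤-trans (subst (suc (length (star r)) ≤_)
                    (sym (trans (length-++ (star r)) (+-suc _ _))) (s≤s (m≤m+n _ _))) p
  ...     | s≤s p′ with K-covers-bounded _ (star r) p′ (odd-prefix (star r) (mirror a) h)
  ...       | t , m∈K = node t (mirror a) , there (∈-map⁺ _ m∈K)

  K-covers-bounded : ∀ n m → length m ≤ n → Odd m → ∃ λ t → m ∈ K t
  K-covers-bounded n       []      p       (inj₁ ())
  K-covers-bounded n       []      p       (inj₂ ())
  K-covers-bounded (suc n) (𝟎 ∷ w) (s≤s p) h with P-covers-bounded n w p (balanced h)
    where
    balanced : Odd (𝟎 ∷ w) → Balanced w
    balanced (inj₁ eq) = inj₁ (sym (suc-injective eq))
    balanced (inj₂ eq) = inj₂ eq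
  ... | t , w∈P = t , ∈K-inner t w∈P
  K-covers-bounded (suc n) (𝟏 ∷ w) (s≤s p) h with left-factor w
  ... | dyck t refl = t , ∈K-first t
  ... | positive q = ⊥-elim (tooHigh h)
    where
    tooHigh : Odd (𝟏 ∷ w) → ⊥
    tooHigh (inj₁ eq) = <⇒≱ q (≤-trans (m≤n+m _ 2) (≤-reflexive (sym eq)))
    tooHigh (inj₂ eq) = <⇒≢ q (sym (suc-injective eq))
  ... | dips a r refl with K-covers-bounded n r (≤-trans (n≤1+n _) (length-dip a r p)) (odd-suffix a r h)
  ...   | t , m∈K = node a t , ∈K-outer a t m∈K

P-covers : ∀ w → Balanced w → ∃ λ t → w ∈ P t
P-covers w = P-covers-bounded (length w) w ≤-refl

data InP (w : Word) : Forest → Set where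
  first : ∀ {t} → w ≡ word t → InP w t
  later : ∀ {a b m} → m ∈ K a → w ≡ m ++ 𝟏 ∷ word b → InP w (node a b)

data InK (m : Word) : Forest → Set where
  first : ∀ {t} → m ≡ 𝟏 ∷ word t → InK m t
  inner : ∀ {t w} → w ∈ P t → m ≡ 𝟎 ∷ w → InK m t
  outer : ∀ {a b l} → l ∈ K b → m ≡ 𝟏 ∷ word a ++ 𝟎 ∷ l → InK m (node a b)

inP : ∀ t {w} → w ∈ P t → InP w t
inP t          (here eq) = first eq
inP (node a b) (there p) with ∈-map⁻ _ p
... | m , m∈K , eq = later m∈K eq

inK : ∀ t {m} → m ∈ K t → InK m t
inK t (here eq) = first eq
inK t (there p) with ∈-++⁻ (map (𝟎 ∷_) (P t)) p
inK t (there p) | inj₁ q with ∈-map⁻ (𝟎 ∷_) q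
... | w , w∈P , eq = inner w∈P eq
inK (node a b) (there p) | inj₂ q with ∈-map⁻ _ q
... | l , l∈K , eq = outer l∈K eq

star-snoc : ∀ m b → star (m ++ 𝟏 ∷ word b) ≡ word (mirror b) ++ 𝟎 ∷ star m
star-snoc m b = begin
  star (m ++ 𝟏 ∷ word b)                 ≡⟨ star-++ m (𝟏 ∷ word b) ⟩
  star (𝟏 ∷ word b) ++ star m            ≡⟨ cong (_++ star m) (star-++ (𝟏 ∷ []) (word b)) ⟩
  (star (word b) ++ 𝟎 ∷ []) ++ star m    ≡⟨ ++-assoc (star (word b)) (𝟎 ∷ []) (star m) ⟩
  star (word b) ++ 𝟎 ∷ star m            ≡⟨ cong (_++ 𝟎 ∷ star m) (word-mirror b) ⟨
  word (mirror b) ++ 𝟎 ∷ star m          ∎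
  where open ≡-Reasoning

snoc-cancel : ∀ m b m′ b′ → m ++ 𝟏 ∷ word b ≡ m′ ++ 𝟏 ∷ word b′ → m ≡ m′ × b ≡ b′
snoc-cancel m b m′ b′ eq
  with word-cancel (mirror b) (mirror b′) (trans (sym (star-snoc m b)) (trans (cong star eq) (star-snoc m′ b′)))
... | eq₁ , eq₂ = trans (sym (star-involutive m)) (trans (cong star eq₂) (star-involutive m′))
                , trans (sym (mirror-involutive b)) (trans (cong mirror eq₁) (mirror-involutive b′))

word≢snoc : ∀ t m b → word t ≢ m ++ 𝟏 ∷ word b
word≢snoc t m b eq = word-nonneg (mirror t) (mirror b)
  (trans (word-mirror t) (trans (cong star eq) (star-snoc m b)))

mutual
  P-disjoint : ∀ s t {w} → w ∈ P s → w ∈ P t → s ≡ t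
  P-disjoint s t p q with inP s p | inP t q
  ... | first refl | first eq = word-injective s t eq
  ... | first refl | later {b = b} {m} _ eq = ⊥-elim (word≢snoc s m b eq)
  ... | later {b = b} {m} _ eq | first refl = ⊥-elim (word≢snoc t m b eq)
  ... | later {a} {b} {m} m∈ refl | later {a′} {b′} {m′} m′∈ eq with snoc-cancel m b m′ b′ eq
  ...   | refl , refl = cong (λ x → node x b) (K-disjoint a a′ m∈ m′∈)

  K-disjoint : ∀ s t {m} → m ∈ K s → m ∈ K t → s ≡ t
  K-disjoint s t p q with inK s p | inK t q
  ... | first refl  | first eq    = word-injective s t (∷-injectiveʳ eq)
  ... | first refl  | inner _ ()
  ... | first refl  | outer {a} _ eq = ⊥-elim (word-nonneg s a (∷-injectiveʳ eq))
  ... | inner _ ()  | first refl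
  ... | outer {a} _ eq | first refl = ⊥-elim (word-nonneg t a (∷-injectiveʳ eq))
  ... | inner _ refl | outer _ ()
  ... | outer _ ()   | inner _ refl
  ... | inner w∈ refl | inner w′∈ refl = P-disjoint s t w∈ w′∈
  ... | outer {a} {b} l∈ refl | outer {a′} {b′} l′∈ eq with word-cancel a a′ (∷-injectiveʳ eq)
  ...   | refl , refl = cong (node a) (K-disjoint b b′ l∈ l′∈)

∉⇒All : ∀ {A : Set} {x : A} {xs} → x ∉ xs → All (x ≢_) xs
∉⇒All {xs = []}     _ = []
∉⇒All {xs = y ∷ ys} p = (λ eq → p (here eq)) ∷ ∉⇒All (λ q → p (there q))

mutual
  P-unique : ∀ t → Unique (P t)
  P-unique ε          = [] ∷ []
  P-unique (node a b) = ∉⇒All notIn ∷ Uniq.map⁺ (λ eq → proj₁ (snoc-cancel _ b _ b eq)) (K-unique a)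
    where
    notIn : word (node a b) ∉ Q (node a b)
    notIn p with ∈-map⁻ (λ m → m ++ 𝟏 ∷ word b) {xs = K a} p
    ... | m , _ , eq = word≢snoc (node a b) m b eq

  K-unique : ∀ t → Unique (K t)
  K-unique t = ∉⇒All notIn ∷ Uniq.++⁺ (Uniq.map⁺ ∷-injectiveʳ (P-unique t)) (D-unique t) disj
    where
    notIn : 𝟏 ∷ word t ∉ map (𝟎 ∷_) (P t) ++ D t
    notIn p with ∈-++⁻ (map (𝟎 ∷_) (P t)) p
    notIn p | inj₁ q with ∈-map⁻ (𝟎 ∷_) q
    ... | _ , _ , ()
    notIn p | inj₂ q with D-outer t q
    ... | a , l , eq = word-nonneg t a (∷-injectiveʳ eq)
    disj : ∀ {m} → ¬ (m ∈ map (𝟎 ∷_) (P t) × m ∈ D t)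
    disj (p , q) with ∈-map⁻ (𝟎 ∷_) p | D-outer t q
    ... | _ , _ , refl | _ , _ , ()

  D-outer : ∀ t {m} → m ∈ D t → ∃₂ λ a l → m ≡ 𝟏 ∷ word a ++ 𝟎 ∷ l
  D-outer (node a b) p with ∈-map⁻ _ p
  ... | l , _ , eq = a , l , eq

  D-unique : ∀ t → Unique (D t)
  D-unique ε          = []
  D-unique (node a b) = Uniq.map⁺ (λ eq → proj₂ (word-cancel a a (∷-injectiveʳ eq))) (K-unique b)

-- The cover relation of the cube

infix 4 _⋖_

data _⋖_ : Word → Word → Set where
  flip  : ∀ {w} → 𝟎 ∷ w ⋖ 𝟏 ∷ w
  later : ∀ {b v w} → v ⋖ w → b ∷ v ⋖ b ∷ w

⋖-++ˡ : ∀ u {v w} → v ⋖ w → u ++ v ⋖ u ++ w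
⋖-++ˡ []      p = p
⋖-++ˡ (b ∷ u) p = later (⋖-++ˡ u p)

⋖-++ʳ : ∀ u {v w} → v ⋖ w → v ++ u ⋖ w ++ u
⋖-++ʳ u flip      = flip
⋖-++ʳ u (later p) = later (⋖-++ʳ u p)

⋖-reverse : ∀ {v w} → v ⋖ w → reverse v ⋖ reverse w
⋖-reverse (flip {w}) rewrite unfold-reverse 𝟎 w | unfold-reverse 𝟏 w = ⋖-++ˡ (reverse w) flip
⋖-reverse (later {b} {v} {w} p) rewrite unfold-reverse b v | unfold-reverse b w = ⋖-++ʳ (b ∷ []) (⋖-reverse p)

⋖-not : ∀ {v w} → v ⋖ w → map not w ⋖ map not v
⋖-not flip      = flip
⋖-not (later p) = later (⋖-not p)

⋖-length : ∀ {v w} → v ⋖ w → length v ≡ length w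
⋖-length flip      = refl
⋖-length (later p) = cong suc (⋖-length p)

⋖-ones : ∀ {v w} → v ⋖ w → ones w ≡ suc (ones v)
⋖-ones flip            = refl
⋖-ones (later {𝟏} p) = cong suc (⋖-ones p)
⋖-ones (later {𝟎} p) = ⋖-ones p

-- Alternating paths

data Side : Set where
  lo hi : Side

module _ {A : Set} (_<·_ : A → A → Set) where

  data Zigzag : Side → Side → A → A → List A → Set where
    stop : ∀ {s a} → Zigzag s s a a (a ∷ [])
    up   : ∀ {s a b c l} → a <· b → Zigzag hi s b c l → Zigzag lo s a c (a ∷ l)
    down : ∀ {s a b c l} → b <· a → Zigzag lo s b c l → Zigzag hi s a c (a ∷ l)

module _ {A : Set} {_<·_ : A → A → Set} where

  joinUp : ∀ {r s a b c d l m} → Zigzag _<·_ r lo a b l → b <· c → Zigzag _<·_ hi s c d m → Zigzag _<·_ r s a d (l ++ m)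
  joinUp stop       e z = up e z
  joinUp (up f y)   e z = up f (joinUp y e z)
  joinUp (down f y) e z = down f (joinUp y e z)

  joinDown : ∀ {r s a b c d l m} → Zigzag _<·_ r hi a b l → c <· b → Zigzag _<·_ lo s c d m → Zigzag _<·_ r s a d (l ++ m)
  joinDown stop       e z = down e z
  joinDown (up f y)   e z = up f (joinDown y e z)
  joinDown (down f y) e z = down f (joinDown y e z)

  zigzag-head : ∀ {r s a b c l} → Zigzag _<·_ r s a c (b ∷ l) → a ≡ b
  zigzag-head stop       = refl
  zigzag-head (up _ _)   = refl
  zigzag-head (down _ _) = refl

  zigzag-reverse : ∀ {r s a b l} → Zigzag _<·_ r s a b l → Zigzag _<·_ s r b a (reverse l)
  zigzag-reverse stop = stop
  zigzag-reverse (up {a = a} {l = l} e z) rewrite unfold-reverse a l = joinDown (zigzag-reverse z) e stop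
  zigzag-reverse (down {a = a} {l = l} e z) rewrite unfold-reverse a l = joinUp (zigzag-reverse z) e stop

module _ {A B : Set} {_<·_ : A → A → Set} {_<∘_ : B → B → Set} (f : A → B) where

  zigzag-map : (∀ {x y} → x <· y → f x <∘ f y) → ∀ {r s a b l} →
    Zigzag _<·_ r s a b l → Zigzag _<∘_ r s (f a) (f b) (map f l)
  zigzag-map h stop       = stop
  zigzag-map h (up e z)   = up (h e) (zigzag-map h z)
  zigzag-map h (down e z) = down (h e) (zigzag-map h z)

opposite : Side → Side
opposite lo = hi
opposite hi = lo

module _ {A B : Set} {_<·_ : A → A → Set} {_<∘_ : B → B → Set} (f : A → B) (anti : ∀ {x y} → x <· y → f y <∘ f x) where

  zigzag-antitone : ∀ {r s a b l} → Zigzag _<·_ r s a b l → Zigzag _<∘_ (opposite r) (opposite s) (f a) (f b) (map f l)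
  zigzag-antitone stop       = stop
  zigzag-antitone (up e z)   = down (anti e) (zigzag-antitone z)
  zigzag-antitone (down e z) = up (anti e) (zigzag-antitone z)

zigzag-length : ∀ {r s a b l} → Zigzag _⋖_ r s a b l → ∀ {w} → w ∈ l → length w ≡ length a
zigzag-length stop       (here refl) = refl
zigzag-length (up e z)   (here refl) = refl
zigzag-length (down e z) (here refl) = refl
zigzag-length (up e z)   (there p)   = trans (zigzag-length z p) (sym (⋖-length e))
zigzag-length (down e z) (there p)   = trans (zigzag-length z p) (⋖-length e)

end : Forest → Word
end ε          = []
end (node a b) = word a ++ 𝟎 ∷ 𝟏 ∷ word b

mutual
  P-zigzag : ∀ t → Zigzag _⋖_ lo lo (word t) (end t) (P t)
  P-zigzag ε          = stop
  P-zigzag (node a b) = up (later (⋖-++ˡ (word a) flip)) (Q-zigzag a b)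

  Q-zigzag : ∀ a b → Zigzag _⋖_ hi lo (𝟏 ∷ word a ++ 𝟏 ∷ word b) (end (node a b)) (Q (node a b))
  Q-zigzag a b = subst (λ e → Zigzag _⋖_ hi lo (𝟏 ∷ word a ++ 𝟏 ∷ word b) e (Q (node a b)))
    (++-assoc (word a) (𝟎 ∷ []) (𝟏 ∷ word b))
    (zigzag-map (λ m → m ++ 𝟏 ∷ word b) (⋖-++ʳ (𝟏 ∷ word b)) (K-zigzag a))

  -- The blocks of `K` fit together because the inner block ends with 0a01b, where a01b is
  -- `end (node a b)`, and the outer block starts with 1a01b.
  K-zigzag : ∀ t → Zigzag _⋖_ hi lo (𝟏 ∷ word t) (word t ++ 𝟎 ∷ []) (K t)
  K-zigzag ε          = down flip stop
  K-zigzag (node a b) = down flip (joinUp (zigzag-map (𝟎 ∷_) later (P-zigzag (node a b))) flip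
    (subst (λ e → Zigzag _⋖_ hi lo (𝟏 ∷ word a ++ 𝟎 ∷ 𝟏 ∷ word b) (𝟏 ∷ e) (D (node a b)))
      (sym (++-assoc (word a) (𝟎 ∷ word b) (𝟎 ∷ [])))
      (zigzag-map (λ m → 𝟏 ∷ word a ++ 𝟎 ∷ m) (λ e → later (⋖-++ˡ (word a) (later e))) (K-zigzag b))))

length-word : ∀ t → length (word t) ≡ size t + size t
length-word t = trans (length-ones-zeros (word t)) (cong₂ _+_ (ones-word t) (zeros-word t))

P-length : ∀ t {w} → w ∈ P t → length w ≡ size t + size t
P-length t w∈P = trans (zigzag-length (P-zigzag t) w∈P) (length-word t)

-- Exchanging the ends of two paths

Unique-resp-↭ : ∀ {A : Set} {xs ys : List A} → xs ↭ ys → Unique xs → Unique ys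
Unique-resp-↭ p = PermS.Unique-resp-↭ (setoid _) (↭⇒↭ₛ p)

deep flat : Forest → Forest → Forest
deep w v = node (node ε w) v
flat w v = node ε (node w v)

-- `P (deep w v)` starts with 110w0v, 110w1v, 010w1v, 011w1v, 001w1v, 101w1v and goes on with
-- 100w1v. `P-flat` runs through the second to sixth of these backwards and then joins the rest.
tail₆ : ∀ {A : Set} → List A → List A
tail₆ (_ ∷ _ ∷ _ ∷ _ ∷ _ ∷ _ ∷ l) = l
tail₆ l = []

-- The 6-cycle 101w0v, 111w0v, 110w0v, 110w1v, 100w1v, 101w1v meets P (deep w v) and P (flat w v)
-- in alternate edges; exchanging its edges swaps the ends of the two paths.
P-deep P-flat : Forest → Forest → List Word
P-deep w v = (𝟏 ∷ 𝟏 ∷ 𝟎 ∷ wv) ∷ (𝟏 ∷ 𝟏 ∷ 𝟏 ∷ wv) ∷ (𝟎 ∷ 𝟏 ∷ 𝟏 ∷ wv) ∷ []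
  where wv = word w ++ 𝟎 ∷ word v
P-flat w v = (𝟏 ∷ 𝟎 ∷ 𝟏 ∷ (word w ++ 𝟎 ∷ word v)) ∷ (𝟏 ∷ 𝟎 ∷ 𝟏 ∷ wv) ∷ (𝟎 ∷ 𝟎 ∷ 𝟏 ∷ wv)
  ∷ (𝟎 ∷ 𝟏 ∷ 𝟏 ∷ wv) ∷ (𝟎 ∷ 𝟏 ∷ 𝟎 ∷ wv) ∷ (𝟏 ∷ 𝟏 ∷ 𝟎 ∷ wv) ∷ tail₆ (P (deep w v))
  where wv = word w ++ 𝟏 ∷ word v

P-deep-zigzag : ∀ w v → Zigzag _⋖_ lo lo (word (deep w v)) (end (flat w v)) (P-deep w v)
P-deep-zigzag w v = up (later (later flip)) (down flip stop)

P-flat-zigzag : ∀ w v → Zigzag _⋖_ lo lo (word (flat w v)) (end (deep w v)) (P-flat w v)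
P-flat-zigzag w v with P-zigzag (deep w v)
... | up _ (down _ (up _ (down _ (up _ (down _ z))))) with zigzag-head z
...   | refl =
  up (later (later (later (⋖-++ˡ (word w) flip)))) (down flip (up (later flip) (down (later (later flip))
    (up flip (down (later flip) z)))))

exchange-↭ : ∀ w v → P-deep w v ++ P-flat w v ↭ P (deep w v) ++ P (flat w v)
exchange-↭ w v = permute _ _ _ _ _ _ _ _ _ (tail₆ (P (deep w v)))
  where
  permute : ∀ {A : Set} (a b c d e f x y z : A) l →
    a ∷ y ∷ z ∷ x ∷ f ∷ e ∷ d ∷ c ∷ b ∷ l ↭ a ∷ b ∷ c ∷ d ∷ e ∷ f ∷ l ++ x ∷ y ∷ z ∷ []
  permute a b c d e f x y z l = ↭-prep a (↭-trans (++-comm-↭ (y ∷ z ∷ x ∷ []) (f ∷ e ∷ d ∷ c ∷ b ∷ l))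
    (++⁺-↭ {x = f ∷ e ∷ d ∷ c ∷ b ∷ l} {y = b ∷ c ∷ d ∷ e ∷ f ∷ l}
      (++⁺ʳ-↭ l (↭-reverse (b ∷ c ∷ d ∷ e ∷ f ∷ []))) (↭-sym (∷↭∷ʳ x (y ∷ z ∷ [])))))

-- Orbits

module _ {A : Set} where

  iter : (A → A) → ℕ → A → A
  iter f zero    x = x
  iter f (suc m) x = f (iter f m x)

  Reach : (A → A) → A → A → Set
  Reach f x y = ∃ λ m → iter f m x ≡ y

  Periodic : (A → A) → A → Set
  Periodic f x = ∃ λ p → iter f (suc p) x ≡ x

  iter-+ : ∀ f m n x → iter f (m + n) x ≡ iter f m (iter f n x)
  iter-+ f zero    n x = refl
  iter-+ f (suc m) n x = cong f (iter-+ f m n x)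

  Reach-refl : ∀ {f x} → Reach f x x
  Reach-refl = 0 , refl

  Reach-trans : ∀ {f x y z} → Reach f x y → Reach f y z → Reach f x z
  Reach-trans {f} {x} (m , refl) (n , refl) = n + m , iter-+ f n m x

  iter-period : ∀ f {p x} → iter f p x ≡ x → ∀ q → iter f (q * p) x ≡ x
  iter-period f eq zero    = refl
  iter-period f {p} {x} eq (suc q) = trans (iter-+ f p (q * p) x) (trans (cong (iter f p) (iter-period f eq q)) eq)

  Reach-sym : ∀ {f x y} → Periodic f x → Reach f x y → Reach f y x
  Reach-sym {f} {x} (p , eq) (m , refl) = m * p ,
    trans (sym (iter-+ f (m * p) m x))
      (trans (cong (λ k → iter f k x) (trans (+-comm (m * p) m) (sym (*-suc m p)))) (iter-period f eq m))

  iter-% : ∀ f {p x} → iter f (suc p) x ≡ x → ∀ m → iter f (m % suc p) x ≡ iter f m x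
  iter-% f {p} {x} eq m = sym (begin
    iter f m x                                              ≡⟨ cong (λ k → iter f k x) (m≡m%n+[m/n]*n m (suc p)) ⟩
    iter f (m % suc p + (m / suc p) * suc p) x              ≡⟨ iter-+ f (m % suc p) _ x ⟩
    iter f (m % suc p) (iter f ((m / suc p) * suc p) x)     ≡⟨ cong (iter f (m % suc p)) (iter-period f eq (m / suc p)) ⟩
    iter f (m % suc p) x                                    ∎)
    where open ≡-Reasoning

  iter-injective : ∀ f → (∀ {x y} → f x ≡ f y → x ≡ y) → ∀ m {x y} → iter f m x ≡ iter f m y → x ≡ y
  iter-injective f inj zero    eq = eq
  iter-injective f inj (suc m) eq = iter-injective f inj m (inj eq)

  iter-return : ∀ f → (∀ {x y} → f x ≡ f y → x ≡ y) → ∀ {i j x} → i < j → iter f i x ≡ iter f j x →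
    iter f (j ∸ i) x ≡ x
  iter-return f inj {i} {j} {x} i<j eq = iter-injective f inj i
    (trans (sym (iter-+ f i (j ∸ i) x)) (trans (cong (λ k → iter f k x) (m+[n∸m]≡n (<⇒≤ i<j))) (sym eq)))

  injective⇒periodic : ∀ f → (∀ {x y} → f x ≡ f y → x ≡ y) → ∀ U {x} → (∀ m → iter f m x ∈ U) → Periodic f x
  injective⇒periodic f inj U {x} h with pigeonhole (n<1+n (length U)) (λ i → index (h (toℕ i)))
  ... | i , j , i<j , eq = (toℕ j ∸ suc (toℕ i)) ,
    subst (λ k → iter f k x ≡ x) (sym (m<n⇒suc-diff i<j)) (iter-return f inj i<j
      (trans (lookup-index (h (toℕ i))) (trans (cong (lookup U) eq) (sym (lookup-index (h (toℕ j)))))))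
    where
    m<n⇒suc-diff : ∀ {m n} → m < n → suc (n ∸ suc m) ≡ n ∸ m
    m<n⇒suc-diff m<n = sym (+-∸-assoc 1 m<n)

  module _ (_≟_ : DecidableEquality A) where

    reach? : ∀ f {x} → Periodic f x → ∀ y → Dec (Reach f x y)
    reach? f {x} (p , eq) y = map′ (λ { (m , _ , e) → m , e })
      (λ { (m , e) → m % suc p , m%n<n m (suc p) , trans (iter-% f eq m) e })
      (anyUpTo? (λ m → iter f m x ≟ y) (suc p))

    -- g is f composed with the transposition of a and b; if these lie on different f-orbits, the orbits merge.
    module Merge (f g : A → A) (f-periodic : ∀ x → Periodic f x) where

      module _ {a b : A} (gb : g b ≡ f a)
               (g-else : ∀ {z} → z ≢ a → z ≢ b → g z ≡ f z) (sep : ¬ Reach f a b) where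

        private
          -- After `b`, the map `g` follows the `f`-orbit of `a`. This orbit never meets `b`, so it
          -- is followed until it comes round to `a`.
          crawl : ∀ m → Reach g b a ⊎ Reach g b (iter f (suc m) a)
          crawl zero = inj₂ (1 , gb)
          crawl (suc m) with crawl m
          ... | inj₁ r = inj₁ r
          ... | inj₂ r with iter f (suc m) a ≟ a | iter f (suc m) a ≟ b
          ...   | yes eq | _      = inj₁ (subst (Reach g b) eq r)
          ...   | no _   | yes eq = ⊥-elim (sep (suc m , eq))
          ...   | no ≢a  | no ≢b  = inj₂ (Reach-trans r (1 , g-else ≢a ≢b))

        merge-half : Reach g b a
        merge-half with f-periodic a
        ... | p , eq with crawl p
        ...   | inj₁ r = r
        ...   | inj₂ r = subst (Reach g b) eq r

      module _ {a b : A} (ga : g a ≡ f b) (gb : g b ≡ f a)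
               (g-else : ∀ {z} → z ≢ a → z ≢ b → g z ≡ f z) (sep : ¬ Reach f a b) where

        merge-joins : Reach g a b
        merge-joins = merge-half ga (λ ≢b ≢a → g-else ≢a ≢b) (sep ∘ Reach-sym (f-periodic b))

        -- Only the `f`-steps out of `a` and `b` are lost. Each is replaced by travelling to the
        -- other of the two points and leaving from there.
        merge-preserves : ∀ {x y} → Reach f x y → Reach g x y
        merge-preserves {x} (zero  , refl) = Reach-refl
        merge-preserves {x} (suc m , refl) = Reach-trans (merge-preserves (m , refl)) (step (iter f m x))
          where
          step : ∀ z → Reach g z (f z)
          step z with z ≟ a | z ≟ b
          ... | yes refl | _        = Reach-trans merge-joins (1 , gb)
          ... | no _     | yes refl = Reach-trans (merge-half gb g-else sep) (1 , ga)
          ... | no ≢a    | no ≢b    = 1 , g-else ≢a ≢b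

-- Rotation of plane trees

-- Swaps the two ends of the first edge and reflects the plane. By `upper-end`, the path of `turn t`
-- in the upper half starts, backwards, right above the end of the path of `t` in the lower half.
turn : Forest → Forest
turn ε          = ε
turn (node a b) = node (mirror b) (mirror a)

turn-involutive : ∀ t → turn (turn t) ≡ t
turn-involutive ε          = refl
turn-involutive (node a b) = cong₂ node (mirror-involutive a) (mirror-involutive b)

size-turn : ∀ t → size (turn t) ≡ size t
size-turn ε          = refl
size-turn (node a b) = cong suc (trans (cong₂ _+_ (size-mirror b) (size-mirror a)) (+-comm (size b) (size a)))

-- Re-roots the tree along its first edge; as a composite of two involutions, the map is injective.
rotate : Forest → Forest
rotate t = mirror (turn t)

rotate-node : ∀ a b → rotate (node a b) ≡ a ⋆ node b ε
rotate-node a b = cong₂ (λ x y → x ⋆ node y ε) (mirror-involutive a) (mirror-involutive b)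

size-rotate : ∀ t → size (rotate t) ≡ size t
size-rotate t = trans (size-mirror (turn t)) (size-turn t)

turn-injective : ∀ {s t} → turn s ≡ turn t → s ≡ t
turn-injective {s} {t} eq = trans (sym (turn-involutive s)) (trans (cong turn eq) (turn-involutive t))

rotate-injective : ∀ {s t} → rotate s ≡ rotate t → s ≡ t
rotate-injective {s} {t} eq = turn-injective
  (trans (sym (mirror-involutive (turn s))) (trans (cong mirror eq) (mirror-involutive (turn t))))

-- Connecting all plane trees

infix 4 _~_ _≈_

data _~_ : Forest → Forest → Set where
  ~-refl  : ∀ {s} → s ~ s
  ~-sym   : ∀ {s t} → s ~ t → t ~ s
  ~-trans : ∀ {s t u} → s ~ t → t ~ u → s ~ u
  turned  : ∀ a b → node a b ~ a ⋆ node b ε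
  pulled  : ∀ w v → deep w v ~ flat w v

≡⇒~ : ∀ {s t} → s ≡ t → s ~ t
≡⇒~ refl = ~-refl

mutual
  -- Re-rooting walks along edges only. Walking once around the first subtree brings the root back
  -- to its place with that subtree now last.
  shift-~ : ∀ a c → node a c ~ c ⋆ node a ε
  shift-~ ε            c = ~-trans (turned ε c) (turned c ε)
  shift-~ (node a₁ a₂) c =
    ~-trans (turned (node a₁ a₂) c) (
    ~-trans (shift-~ a₁ (a₂ ⋆ node c ε)) (
    ~-trans (≡⇒~ (⋆-assoc a₂ (node c ε) (node a₁ ε))) (
    ~-trans (comm-~ a₂ (node c (node a₁ ε)))
            (turned c (node a₁ a₂)))))

  comm-~ : ∀ b c → b ⋆ c ~ c ⋆ b
  comm-~ ε            c = ≡⇒~ (sym (⋆-identityʳ c))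
  comm-~ (node b₁ b₂) c =
    ~-trans (shift-~ b₁ (b₂ ⋆ c)) (
    ~-trans (≡⇒~ (⋆-assoc b₂ c (node b₁ ε))) (
    ~-trans (comm-~ b₂ (c ⋆ node b₁ ε))
            (≡⇒~ (⋆-assoc c (node b₁ ε) b₂))))

-- Unlike ~, this relation is a congruence.
_≈_ : Forest → Forest → Set
s ≈ t = ∀ d → s ⋆ d ~ t ⋆ d

≈-trans : ∀ {s t u} → s ≈ t → t ≈ u → s ≈ u
≈-trans p q d = ~-trans (p d) (q d)

-- Re-rooting along the first edge brings `s` to the front of the top level, where the arbitrary
-- context `d` absorbs everything else.
≈-nodeˡ : ∀ {s t} c → s ≈ t → node s c ≈ node t c
≈-nodeˡ {s} {t} c p d = ~-trans (turned s (c ⋆ d)) (~-trans (p (node (c ⋆ d) ε)) (~-sym (turned t (c ⋆ d))))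

≈-nodeʳ : ∀ {s t} a → s ≈ t → node a s ≈ node a t
≈-nodeʳ {s} {t} a p d =
  ~-trans (shift-~ a (s ⋆ d)) (~-trans (≡⇒~ (⋆-assoc s d (node a ε))) (~-trans (p (d ⋆ node a ε))
    (~-sym (~-trans (shift-~ a (t ⋆ d)) (≡⇒~ (⋆-assoc t d (node a ε)))))))

-- The star rooted at its centre; its word is (10)ⁿ. It is the common normal form of the trees with
-- `n` edges.
comb : ℕ → Forest
comb zero    = ε
comb (suc n) = node ε (comb n)

-- The first subtree loses one leaf at a time to the root.
node-comb : ∀ i j → node (comb i) (comb j) ≈ comb (suc (i + j))
node-comb zero    j d = ~-refl
node-comb (suc i) j = ≈-trans (λ d → pulled (comb i) (comb j ⋆ d)) (≈-nodeʳ ε (node-comb i j))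

≈-comb : ∀ t → t ≈ comb (size t)
≈-comb ε          d = ~-refl
≈-comb (node a b) = ≈-trans (≈-nodeˡ b (≈-comb a)) (≈-trans (≈-nodeʳ (comb (size a)) (≈-comb b)) (node-comb (size a) (size b)))

~-comb : ∀ t → t ~ comb (size t)
~-comb t = subst₂ _~_ (⋆-identityʳ t) (⋆-identityʳ _) (≈-comb t ε)

size-comb : ∀ n → size (comb n) ≡ n
size-comb zero    = refl
size-comb (suc n) = cong suc (size-comb n)

~-size : ∀ {s t} → s ~ t → size s ≡ size t
~-size ~-refl        = refl
~-size (~-sym p)     = sym (~-size p)
~-size (~-trans p q) = trans (~-size p) (~-size q)
~-size (turned a b)  = sym (trans (size-⋆ a (node b ε)) (trans (+-suc (size a) _) (cong (suc ∘ (size a +_)) (+-identityʳ (size b)))))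
~-size (pulled w v)  = refl

-- Merging all rotation orbits

infix 4 _≟ᶠ_

_≟ᶠ_ : DecidableEquality Forest
ε        ≟ᶠ ε          = yes refl
ε        ≟ᶠ node _ _   = no λ ()
node _ _ ≟ᶠ ε          = no λ ()
node a b ≟ᶠ node a′ b′ = map′ (λ { (refl , refl) → refl }) (λ { refl → refl , refl }) ((a ≟ᶠ a′) ×-dec (b ≟ᶠ b′))

-- The pairs deep w v, flat w v for which the ends of the paths are exchanged.
Marks : Set
Marks = Forest → Forest → Bool

-- The two patterns exclude each other and determine `w` and `v`. Hence exchanges do not interfere,
-- and this is an involution for every choice of marks.
exchange : Marks → Forest → Forest
exchange S (node ε (node w v))          = if S w v then deep w v else flat w v
exchange S (node (node ε w) v)          = if S w v then flat w v else deep w v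
exchange S t                            = t

exchange-involutive : ∀ S t → exchange S (exchange S t) ≡ t
exchange-involutive S ε = refl
exchange-involutive S (node ε ε) = refl
exchange-involutive S (node ε (node w v)) with S w v in eq
... | true  rewrite eq = refl
... | false rewrite eq = refl
exchange-involutive S (node (node ε w) v) with S w v in eq
... | true  rewrite eq = refl
... | false rewrite eq = refl
exchange-involutive S (node (node (node _ _) _) _) = refl

size-exchange : ∀ S t → size (exchange S t) ≡ size t
size-exchange S ε = refl
size-exchange S (node ε ε) = refl
size-exchange S (node ε (node w v)) with S w v
... | true  = refl
... | false = refl
size-exchange S (node (node ε w) v) with S w v
... | true  = refl
... | false = refl
size-exchange S (node (node (node _ _) _) _) = refl

-- The path from `word t` ends where `P (exchange S t)` does, and the return through the upper half
-- rotates that tree. So the orbits of this map are the cycles after the exchanges.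
next : Marks → Forest → Forest
next S t = rotate (exchange S t)

next-injective : ∀ S {s t} → next S s ≡ next S t → s ≡ t
next-injective S {s} {t} eq = trans (sym (exchange-involutive S s))
  (trans (cong (exchange S) (rotate-injective {exchange S s} {exchange S t} eq)) (exchange-involutive S t))

size-next : ∀ S t → size (next S t) ≡ size t
size-next S t = trans (size-rotate (exchange S t)) (size-exchange S t)

size-iter-next : ∀ S m t → size (iter (next S) m t) ≡ size t
size-iter-next S zero    t = refl
size-iter-next S (suc m) t = trans (size-next S (iter (next S) m t)) (size-iter-next S m t)

-- The forests of height at most `h` when read as binary trees: a finite list that includes those of
-- size at most `h`.
forests : ℕ → List Forest
forests zero    = ε ∷ []
forests (suc h) = ε ∷ cartesianProductWith node (forests h) (forests h)

∈-forests : ∀ h t → size t ≤ h → t ∈ forests h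
∈-forests zero    ε          p       = here refl
∈-forests (suc h) ε          p       = here refl
∈-forests (suc h) (node a b) (s≤s p) = there (∈-cartesianProductWith⁺ node
  (∈-forests h a (≤-trans (m≤m+n _ _) p)) (∈-forests h b (≤-trans (m≤n+m _ _) p)))

next-periodic : ∀ S t → Periodic (next S) t
next-periodic S t = injective⇒periodic (next S) (next-injective S) (forests (size t))
  (λ m → ∈-forests (size t) _ (≤-reflexive (size-iter-next S m t)))

unmarked : Marks
unmarked _ _ = false

mark : Forest → Forest → Marks → Marks
mark w₀ v₀ S w v with w ≟ᶠ w₀ | v ≟ᶠ v₀
... | yes _ | yes _ = true
... | _     | _     = S w v

mark-self : ∀ w v S → mark w v S w v ≡ true
mark-self w v S with w ≟ᶠ w | v ≟ᶠ v
... | yes _  | yes _  = refl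
... | no ≢w  | _      = ⊥-elim (≢w refl)
... | yes _  | no ≢v  = ⊥-elim (≢v refl)

mark-cases : ∀ w₀ v₀ S w v → (w ≡ w₀ × v ≡ v₀) ⊎ mark w₀ v₀ S w v ≡ S w v
mark-cases w₀ v₀ S w v with w ≟ᶠ w₀ | v ≟ᶠ v₀
... | yes p | yes q = inj₁ (p , q)
... | yes _ | no _  = inj₂ refl
... | no _  | yes _ = inj₂ refl
... | no _  | no _  = inj₂ refl

exchange-mark : ∀ w₀ v₀ S {t} → t ≢ deep w₀ v₀ → t ≢ flat w₀ v₀ → exchange (mark w₀ v₀ S) t ≡ exchange S t
exchange-mark w₀ v₀ S {ε} _ _ = refl
exchange-mark w₀ v₀ S {node ε ε} _ _ = refl
exchange-mark w₀ v₀ S {node ε (node w v)} _ ≢flat with mark-cases w₀ v₀ S w v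
... | inj₁ (refl , refl) = ⊥-elim (≢flat refl)
... | inj₂ eq rewrite eq = refl
exchange-mark w₀ v₀ S {node (node ε w) v} ≢deep _ with mark-cases w₀ v₀ S w v
... | inj₁ (refl , refl) = ⊥-elim (≢deep refl)
... | inj₂ eq rewrite eq = refl
exchange-mark w₀ v₀ S {node (node (node _ _) _) _} _ _ = refl

-- The invariant of a greedy choice over the list `l` of pairs. By `marked`, a pair that is still
-- separated is unmarked, so marking it really changes `next`, by a transposition. Together,
-- `rotations` and `pairs` make the generators of `_~_` reachable.
record Glued (l : List (Forest × Forest)) : Set where
  field
    marks     : Marks
    rotations : ∀ {s t} → Reach rotate s t → Reach (next marks) s t
    marked    : ∀ w v → marks w v ≡ true → Reach (next marks) (deep w v) (flat w v)
    pairs     : ∀ {w v} → (w , v) ∈ l → Reach (next marks) (deep w v) (flat w v)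

iter-cong : ∀ {A : Set} {f g : A → A} → (∀ x → f x ≡ g x) → ∀ m x → iter f m x ≡ iter g m x
iter-cong h zero x = refl
iter-cong {f = f} h (suc m) x = trans (cong f (iter-cong h m x)) (h _)

exchange-unmarked : ∀ t → exchange unmarked t ≡ t
exchange-unmarked ε = refl
exchange-unmarked (node ε ε) = refl
exchange-unmarked (node ε (node w v)) = refl
exchange-unmarked (node (node ε w) v) = refl
exchange-unmarked (node (node (node _ _) _) _) = refl

module Gluing {l} (G : Glued l) {w₀ v₀ : Forest} (sep : ¬ Reach (next (Glued.marks G)) (deep w₀ v₀) (flat w₀ v₀)) where

  open Glued G

  marks⁺ : Marks
  marks⁺ = mark w₀ v₀ marks

  unmarked-pair : marks w₀ v₀ ≡ false
  unmarked-pair with marks w₀ v₀ in eq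
  ... | false = refl
  ... | true  = ⊥-elim (sep (marked w₀ v₀ eq))

  next-deep : next marks⁺ (deep w₀ v₀) ≡ next marks (flat w₀ v₀)
  next-deep = cong rotate (trans (cong (λ b → if b then flat w₀ v₀ else deep w₀ v₀) (mark-self w₀ v₀ marks))
    (cong (λ b → if b then deep w₀ v₀ else flat w₀ v₀) (sym unmarked-pair)))

  next-flat : next marks⁺ (flat w₀ v₀) ≡ next marks (deep w₀ v₀)
  next-flat = cong rotate (trans (cong (λ b → if b then deep w₀ v₀ else flat w₀ v₀) (mark-self w₀ v₀ marks))
    (cong (λ b → if b then flat w₀ v₀ else deep w₀ v₀) (sym unmarked-pair)))

  next-else : ∀ {z} → z ≢ deep w₀ v₀ → z ≢ flat w₀ v₀ → next marks⁺ z ≡ next marks z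
  next-else p q = cong rotate (exchange-mark w₀ v₀ marks p q)

  open Merge _≟ᶠ_ (next marks) (next marks⁺) (next-periodic marks)

  joined : Reach (next marks⁺) (deep w₀ v₀) (flat w₀ v₀)
  joined = merge-joins next-deep next-flat next-else sep

  kept : ∀ {x y} → Reach (next marks) x y → Reach (next marks⁺) x y
  kept = merge-preserves next-deep next-flat next-else sep

  glued : Glued ((w₀ , v₀) ∷ l)
  glued = record
    { marks     = marks⁺
    ; rotations = λ r → kept (rotations r)
    ; marked    = λ w v eq → [ (λ { (refl , refl) → joined }) , (λ eq′ → kept (marked w v (trans (sym eq′) eq))) ]′
                    (mark-cases w₀ v₀ marks w v)
    ; pairs     = λ { (here refl) → joined ; (there p) → kept (pairs p) }
    }

glue-pair : ∀ {l} (G : Glued l) w v → Dec (Reach (next (Glued.marks G)) (deep w v) (flat w v)) → Glued ((w , v) ∷ l)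
glue-pair G w v (yes r) = record
  { marks     = marks
  ; rotations = rotations
  ; marked    = marked
  ; pairs     = λ { (here refl) → r ; (there p) → pairs p }
  }
  where open Glued G
glue-pair G w v (no sep) = Gluing.glued G sep

glue : ∀ l → Glued l
glue [] = record
  { marks     = unmarked
  ; rotations = λ { {s} (m , eq) → m , trans (iter-cong (λ x → cong rotate (exchange-unmarked x)) m s) eq }
  ; marked    = λ _ _ ()
  ; pairs     = λ ()
  }
glue ((w , v) ∷ l) = glue-pair (glue l) w v
  (reach? _≟ᶠ_ (next (Glued.marks (glue l))) (next-periodic (Glued.marks (glue l)) (deep w v)) (flat w v))

single-orbit : ∀ n → ∃ λ S → ∀ t → size t ≡ n → Reach (next S) (comb n) t
single-orbit n = marks , λ t eq → reach-~ (~-sym (subst (λ k → t ~ comb k) eq (~-comb t))) (≤-reflexive (size-comb n))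
  where
  open Glued (glue (cartesianProduct (forests n) (forests n)))
  reach-~ : ∀ {s t} → s ~ t → size s ≤ n → Reach (next marks) s t
  reach-~ ~-refl p = Reach-refl
  reach-~ (~-sym r) p = Reach-sym (next-periodic marks _) (reach-~ r (subst (_≤ n) (sym (~-size r)) p))
  reach-~ (~-trans r s) p = Reach-trans (reach-~ r p) (reach-~ s (subst (_≤ n) (~-size r) p))
  reach-~ (turned a b) p = rotations (1 , rotate-node a b)
  reach-~ (pulled w v) p = pairs (∈-cartesianProduct⁺
    (∈-forests n w (≤-trans (≤-trans (m≤m+n (size w) (size v)) (m≤n+m _ 2)) p))
    (∈-forests n v (≤-trans (≤-trans (m≤n+m (size v) (size w)) (m≤n+m _ 2)) p)))

-- The exchanged paths

path : Marks → Forest → List Word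
path S (node ε (node w v)) = if S w v then P-flat w v else P (flat w v)
path S (node (node ε w) v) = if S w v then P-deep w v else P (deep w v)
path S t                   = P t

data Exchanged : Forest → List Word → Forest → Set where
  plain  : ∀ t → Exchanged t (P t) t
  deeper : ∀ w v → Exchanged (deep w v) (P-deep w v) (flat w v)
  flatter : ∀ w v → Exchanged (flat w v) (P-flat w v) (deep w v)

exchanged : ∀ S t → Exchanged t (path S t) (exchange S t)
exchanged S ε = plain _
exchanged S (node ε ε) = plain _
exchanged S (node ε (node w v)) with S w v
... | true  = flatter w v
... | false = plain _
exchanged S (node (node ε w) v) with S w v
... | true  = deeper w v
... | false = plain _
exchanged S (node (node (node _ _) _) _) = plain _

path-zigzag : ∀ S t → Zigzag _⋖_ lo lo (word t) (end (exchange S t)) (path S t)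
path-zigzag S t with path S t | exchange S t | exchanged S t
... | _ | _ | plain .t    = P-zigzag t
... | _ | _ | deeper w v  = P-deep-zigzag w v
... | _ | _ | flatter w v = P-flat-zigzag w v

deep-flat-unique : ∀ w v → Unique (P-deep w v ++ P-flat w v)
deep-flat-unique w v = Unique-resp-↭ (↭-sym (exchange-↭ w v))
  (Uniq.++⁺ (P-unique (deep w v)) (P-unique (flat w v)) λ (p , q) → deep≢flat (P-disjoint (deep w v) (flat w v) p q))
  where
  deep≢flat : deep w v ≢ flat w v
  deep≢flat ()

module _ {A : Set} where

  unique-++ˡ : ∀ xs {ys : List A} → Unique (xs ++ ys) → Unique xs
  unique-++ˡ []       _        = []
  unique-++ˡ (x ∷ xs) (p ∷ ps) = ∉⇒All (λ x∈ → All.lookup p (∈-++⁺ˡ x∈) refl) ∷ unique-++ˡ xs ps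

  unique-++ʳ : ∀ xs {ys : List A} → Unique (xs ++ ys) → Unique ys
  unique-++ʳ []       ps       = ps
  unique-++ʳ (x ∷ xs) (_ ∷ ps) = unique-++ʳ xs ps

  unique-++-disjoint : ∀ xs {ys : List A} {x} → Unique (xs ++ ys) → x ∈ xs → x ∈ ys → ⊥
  unique-++-disjoint (x ∷ xs) (p ∷ _)  (here refl) q = All.lookup p (∈-++⁺ʳ xs q) refl
  unique-++-disjoint (x ∷ xs) (_ ∷ ps) (there r)   q = unique-++-disjoint xs ps r q

path-unique : ∀ S t → Unique (path S t)
path-unique S t with path S t | exchange S t | exchanged S t
... | _ | _ | plain .t    = P-unique t
... | _ | _ | deeper w v  = unique-++ˡ (P-deep w v) (deep-flat-unique w v)
... | _ | _ | flatter w v = unique-++ʳ (P-deep w v) (deep-flat-unique w v)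

path⇒P : ∀ S t {w} → w ∈ path S t → w ∈ P t ⊎ w ∈ P (exchange S t)
path⇒P S t p with path S t | exchange S t | exchanged S t
... | _ | _ | plain .t    = inj₁ p
... | _ | _ | deeper w v  = ∈-++⁻ (P (deep w v)) (∈-resp-↭ (exchange-↭ w v) (∈-++⁺ˡ p))
... | _ | _ | flatter w v = swap (∈-++⁻ (P (deep w v)) (∈-resp-↭ (exchange-↭ w v) (∈-++⁺ʳ (P-deep w v) p)))

P⇒path : ∀ S t {w} → w ∈ P t → w ∈ path S t ⊎ w ∈ path S (exchange S t)
P⇒path S ε p = inj₁ p
P⇒path S (node ε ε) p = inj₁ p
P⇒path S (node ε (node w v)) p with S w v in eq
... | false = inj₁ p
... | true rewrite eq = swap (∈-++⁻ (P-deep w v) (∈-resp-↭ (↭-sym (exchange-↭ w v)) (∈-++⁺ʳ (P (deep w v)) p)))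
P⇒path S (node (node ε w) v) p with S w v in eq
... | false = inj₁ p
... | true rewrite eq = ∈-++⁻ (P-deep w v) (∈-resp-↭ (↭-sym (exchange-↭ w v)) (∈-++⁺ˡ p))
P⇒path S (node (node (node _ _) _) _) p = inj₁ p

-- Two exchanged paths together rearrange the words of two disjoint paths without repetitions, so
-- they are disjoint again.
path-exchange-disjoint : ∀ S t {w} → w ∈ path S t → w ∈ path S (exchange S t) → exchange S t ≡ t
path-exchange-disjoint S ε p q = refl
path-exchange-disjoint S (node ε ε) p q = refl
path-exchange-disjoint S (node ε (node w v)) p q with S w v in eq
... | false = refl
... | true rewrite eq = ⊥-elim (unique-++-disjoint (P-deep w v) (deep-flat-unique w v) q p)
path-exchange-disjoint S (node (node ε w) v) p q with S w v in eq
... | false = refl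
... | true rewrite eq = ⊥-elim (unique-++-disjoint (P-deep w v) (deep-flat-unique w v) p q)
path-exchange-disjoint S (node (node (node _ _) _) _) p q = refl

exchange-injective : ∀ S {s t} → exchange S s ≡ exchange S t → s ≡ t
exchange-injective S {s} {t} eq = trans (sym (exchange-involutive S s)) (trans (cong (exchange S) eq) (exchange-involutive S t))

path-disjoint : ∀ S s t {w} → w ∈ path S s → w ∈ path S t → s ≡ t
path-disjoint S s t p q with path⇒P S s p | path⇒P S t q
... | inj₁ p′ | inj₁ q′ = P-disjoint s t p′ q′
... | inj₂ p′ | inj₂ q′ = exchange-injective S (P-disjoint _ _ p′ q′)
... | inj₁ p′ | inj₂ q′ with P-disjoint _ _ p′ q′
...   | refl = path-exchange-disjoint S t q p
path-disjoint S s t p q | inj₂ p′ | inj₁ q′ with P-disjoint _ _ p′ q′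
...   | refl = sym (path-exchange-disjoint S s p q)

-- The middle levels cycle

-- The two halves of the cube. Reversing the words in the first half makes the tour start and end as needed
-- for the closing chains below.

lower upper : Word → Word
lower w = 𝟎 ∷ reverse w
upper w = 𝟏 ∷ map not w

lower-injective : ∀ {v w} → lower v ≡ lower w → v ≡ w
lower-injective eq = reverse-injective (∷-injectiveʳ eq)

upper-injective : ∀ {v w} → upper v ≡ upper w → v ≡ w
upper-injective {v} {w} eq = trans (sym (map-not-involutive v)) (trans (cong (map not) (∷-injectiveʳ eq)) (map-not-involutive w))

-- The word directly above `lower (word t)`. By `top-rotate`, it is also where the passage through
-- the upper half ends for the tree that rotates to `t`.
top : Forest → Word
top t = 𝟏 ∷ reverse (word t)

top-rotate : ∀ t → top (rotate t) ≡ upper (word (turn t))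
top-rotate t = cong (𝟏 ∷_) (begin
  reverse (word (mirror (turn t)))      ≡⟨ cong reverse (word-mirror (turn t)) ⟩
  reverse (map not (reverse (word (turn t)))) ≡⟨ reverse-map not (reverse (word (turn t))) ⟨
  map not (reverse (reverse (word (turn t)))) ≡⟨ cong (map not) (reverse-involutive (word (turn t))) ⟩
  map not (word (turn t)) ∎)
  where open ≡-Reasoning

not-mirror : ∀ a → map not (word (mirror a)) ≡ reverse (word a)
not-mirror a = trans (cong (map not) (word-mirror a)) (map-not-involutive (reverse (word a)))

-- `turn` acts on the last words of the paths as `star`, so the crossing between the halves flips
-- the first letter only.
upper-end : ∀ t → upper (end (turn t)) ≡ 𝟏 ∷ reverse (end t)
upper-end ε          = refl
upper-end (node a b) = cong (𝟏 ∷_) (begin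
  map not (word (mirror b) ++ 𝟎 ∷ 𝟏 ∷ word (mirror a))      ≡⟨ map-++ not (word (mirror b)) _ ⟩
  map not (word (mirror b)) ++ 𝟏 ∷ 𝟎 ∷ map not (word (mirror a)) ≡⟨ cong₂ (λ x y → x ++ 𝟏 ∷ 𝟎 ∷ y) (not-mirror b) (not-mirror a) ⟩
  reverse (word b) ++ 𝟏 ∷ 𝟎 ∷ reverse (word a)              ≡⟨ ++-assoc (reverse (word b)) (𝟏 ∷ 𝟎 ∷ []) _ ⟨
  (reverse (word b) ++ 𝟏 ∷ 𝟎 ∷ []) ++ reverse (word a)      ≡⟨ cong (_++ reverse (word a)) (reverse-++ (𝟎 ∷ 𝟏 ∷ []) (word b)) ⟨
  reverse (𝟎 ∷ 𝟏 ∷ word b) ++ reverse (word a)              ≡⟨ reverse-++ (word a) (𝟎 ∷ 𝟏 ∷ word b) ⟨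
  reverse (word a ++ 𝟎 ∷ 𝟏 ∷ word b) ∎)
  where open ≡-Reasoning

second : Forest → Word
second ε          = []
second (node a b) = 𝟏 ∷ word a ++ 𝟏 ∷ word b

-- The last vertex is split off because the whole tour must stop on the lower level; the vertex
-- missing from the final segment later forms the closing chain.
segment⁻ segment : Marks → Forest → List Word
segment⁻ S t = map lower (path S t) ++ map upper (reverse (Q (turn (exchange S t))))
segment  S t = segment⁻ S t ++ top (next S t) ∷ []

segment-zigzag : ∀ S t {k} → size t ≡ suc k →
  Zigzag _⋖_ lo lo (lower (word t)) (upper (second (turn (exchange S t)))) (segment⁻ S t)
segment-zigzag S t eq with exchange S t | trans (size-exchange S t) eq | path-zigzag S t
... | node a b | _ | z = joinUp (zigzag-map lower (λ e → later (⋖-reverse e)) z)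
  (subst (lower (end (node a b)) ⋖_) (sym (upper-end (node a b))) flip)
  (zigzag-antitone upper (λ e → later (⋖-not e)) (zigzag-reverse (Q-zigzag (mirror b) (mirror a))))

second⋖top : ∀ t {k} → size t ≡ suc k → upper (second (turn t)) ⋖ top (rotate t)
second⋖top t@(node a b) _ = subst (upper (second (turn t)) ⋖_) (sym (top-rotate t))
  (later (⋖-not {v = word (turn t)} (later (⋖-++ˡ (word (mirror b)) flip))))

segment-↭ : ∀ S t → segment S t ↭ map lower (path S t) ++ map upper (P (turn (exchange S t)))
segment-↭ S t = ↭-trans (++-assoc-↭ (map lower (path S t)) _ _) (++⁺ˡ-↭ (map lower (path S t))
  (↭-trans (↭-reflexive (cong (λ x → map upper (reverse (Q t′)) ++ x ∷ []) (top-rotate (exchange S t))))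
  (↭-trans (↭-sym (∷↭∷ʳ (upper (word t′)) (map upper (reverse (Q t′))))) (↭-prep _ (map⁺ upper (↭-reverse (Q t′)))))))
  where t′ = turn (exchange S t)

data InSegment (S : Marks) (t : Forest) : Word → Set where
  inLower : ∀ {w} → w ∈ path S t → InSegment S t (lower w)
  inUpper : ∀ {w} → w ∈ P (turn (exchange S t)) → InSegment S t (upper w)

inSegment : ∀ S t {w} → w ∈ segment S t → InSegment S t w
inSegment S t p with ∈-++⁻ (map lower (path S t)) (∈-resp-↭ (segment-↭ S t) p)
... | inj₁ q with ∈-map⁻ lower q
...   | w , w∈ , refl = inLower w∈
inSegment S t p | inj₂ q with ∈-map⁻ upper q
...   | w , w∈ , refl = inUpper w∈

segment-disjoint : ∀ S s t {w} → w ∈ segment S s → w ∈ segment S t → s ≡ t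
segment-disjoint S s t p q = go (inSegment S s p) (inSegment S t q) refl
  where
  go : ∀ {v w} → InSegment S s v → InSegment S t w → v ≡ w → s ≡ t
  go (inLower {v} p) (inLower {w} q) eq with lower-injective {v} {w} eq
  ... | refl = path-disjoint S s t p q
  go (inUpper {v} p) (inUpper {w} q) eq with upper-injective {v} {w} eq
  ... | refl = exchange-injective S (turn-injective {exchange S s} {exchange S t} (P-disjoint _ _ p q))
  go (inLower _) (inUpper _) ()
  go (inUpper _) (inLower _) ()

segment-unique : ∀ S t → Unique (segment S t)
segment-unique S t = Unique-resp-↭ (↭-sym (segment-↭ S t)) (Uniq.++⁺
  (Uniq.map⁺ lower-injective (path-unique S t))
  (Uniq.map⁺ upper-injective (P-unique (turn (exchange S t)))) disjoint)
  where
  disjoint : ∀ {w} → ¬ (w ∈ map lower (path S t) × w ∈ map upper (P (turn (exchange S t))))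
  disjoint (p , q) with ∈-map⁻ lower p | ∈-map⁻ upper q
  ... | _ , _ , refl | _ , _ , ()

segments-cover : ∀ S k w → length w ≡ suc (k + k) → ones w ≡ k ⊎ ones w ≡ suc k → ∃ λ t → size t ≡ k × w ∈ segment S t
segments-cover S k (b ∷ r) len h = go b len h
  where
  double-injective : ∀ m n → m + m ≡ n + n → m ≡ n
  double-injective zero    zero    _  = refl
  double-injective (suc m) (suc n) eq = cong suc (double-injective m n
    (suc-injective (trans (sym (+-suc m m)) (trans (suc-injective eq) (+-suc n n)))))
  size-P : ∀ t {w} → length w ≡ k + k → w ∈ P t → size t ≡ k
  size-P t len p = double-injective _ _ (trans (sym (P-length t p)) len)
  count : ∀ {m n} → m + n ≡ k + k → m ≡ k ⊎ m ≡ suc k → m ≡ n ⊎ m ≡ 2 + n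
  count {n = n} s (inj₁ refl) = inj₁ (sym (+-cancelˡ-≡ k n k s))
  count {n = n} s (inj₂ refl) = inj₂ (cong suc (sym (+-cancelˡ-≡ k (suc n) k (trans (+-suc k n) s))))
  count′ : ∀ {m n} → m + n ≡ k + k → suc m ≡ k ⊎ suc m ≡ suc k → n ≡ m ⊎ n ≡ 2 + m
  count′ {m} {n} s (inj₁ refl) = inj₂ (+-cancelˡ-≡ m n (2 + m) (trans s (sym (trans (+-suc m (suc m)) refl))))
  count′ {m} {n} s (inj₂ refl) = inj₁ (+-cancelˡ-≡ m n m s)
  total : ones r + zeros r ≡ k + k
  total = trans (sym (length-ones-zeros r)) (suc-injective len)
  go : ∀ b → length (b ∷ r) ≡ suc (k + k) → ones (b ∷ r) ≡ k ⊎ ones (b ∷ r) ≡ suc k →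
    ∃ λ t → size t ≡ k × b ∷ r ∈ segment S t
  go 𝟎 len h with P-covers (reverse r)
    (subst₂ (λ m n → m ≡ n ⊎ m ≡ 2 + n) (sym (ones-reverse r)) (sym (zeros-reverse r)) (count total h))
  ... | t , p = [ found t refl , found (exchange S t) (size-exchange S t) ]′ (P⇒path S t p)
    where
    found : ∀ s → size s ≡ size t → reverse r ∈ path S s → ∃ λ t → size t ≡ k × 𝟎 ∷ r ∈ segment S t
    found s eq q = s , trans eq (size-P t (trans (length-reverse r) (suc-injective len)) p) ,
      ∈-resp-↭ (↭-sym (segment-↭ S s)) (∈-++⁺ˡ
        (subst (_∈ map lower (path S s)) (cong (𝟎 ∷_) (reverse-involutive r)) (∈-map⁺ lower q)))
  go 𝟏 len h with P-covers (map not r)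
    (subst₂ (λ m n → m ≡ n ⊎ m ≡ 2 + n) (sym (ones-not r)) (sym (zeros-not r)) (count′ total h))
  ... | t , p = s , trans (trans (size-exchange S (turn t)) (size-turn t))
        (size-P t (trans (length-map not r) (suc-injective len)) p) ,
      ∈-resp-↭ (↭-sym (segment-↭ S s)) (∈-++⁺ʳ (map lower (path S s))
        (subst₂ (λ x y → 𝟏 ∷ x ∈ map upper (P y)) (map-not-involutive r)
          (sym (trans (cong turn (exchange-involutive S (turn t))) (turn-involutive t))) (∈-map⁺ upper p)))
    -- Both maps are involutions, so `turn (exchange S s)` is `t`.
    where s = exchange S (turn t)

-- Concatenating the segments along an orbit

module _ {A : Set} (f : A → A) where

  iter-comm : ∀ m x → iter f m (f x) ≡ f (iter f m x)
  iter-comm zero    x = refl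
  iter-comm (suc m) x = cong f (iter-comm m x)

  ∈-iterate⁺ : ∀ {i n} x → i < n → iter f i x ∈ iterate f x n
  ∈-iterate⁺ {zero}  {suc n} x _       = here refl
  ∈-iterate⁺ {suc i} {suc n} x (s≤s p) = there (subst (_∈ iterate f (f x) n) (iter-comm i x) (∈-iterate⁺ (f x) p))

  ∈-iterate⁻ : ∀ n {x y} → y ∈ iterate f x n → ∃ λ i → i < n × y ≡ iter f i x
  ∈-iterate⁻ (suc n) (here eq) = 0 , s≤s z≤n , eq
  ∈-iterate⁻ (suc n) {x} (there p) with ∈-iterate⁻ n p
  ... | i , i<n , eq = suc i , s≤s i<n , trans eq (iter-comm i x)

  iterate-unique : (∀ {x y} → f x ≡ f y → x ≡ y) → ∀ n {x} →
    (∀ {i} → suc i < n → iter f (suc i) x ≢ x) → Unique (iterate f x n)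
  iterate-unique inj zero    h = []
  iterate-unique inj (suc n) {x} h = ∉⇒All x∉ ∷ iterate-unique inj n
    (λ {i} p eq → h (m≤n⇒m≤1+n p) (inj (trans (cong f (sym (iter-comm i x))) eq)))
    where
    x∉ : x ∉ iterate f (f x) n
    x∉ p with ∈-iterate⁻ n p
    ... | i , i<n , eq = h (s≤s i<n) (sym (trans eq (iter-comm i x)))

least : ∀ {P : ℕ → Set} → (∀ n → Dec (P n)) → ∀ {n} → P n → ∃ λ m → P m × (∀ {i} → i < m → ¬ P i)
least P? {n} p with P? 0
... | yes p₀ = 0 , p₀ , λ ()
least P? {zero}  p | no ¬p₀ = ⊥-elim (¬p₀ p)
least P? {suc n} p | no ¬p₀ with least (λ m → P? (suc m)) p
... | m , pm , min = suc m , pm , λ { {zero} _ → ¬p₀ ; {suc i} (s≤s i<m) → min i<m }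

least-period : ∀ {A : Set} (_≟_ : DecidableEquality A) f {x} → Periodic f x →
  ∃ λ p → iter f (suc p) x ≡ x × (∀ {i} → i < p → iter f (suc i) x ≢ x)
least-period _≟_ f {x} (p , eq) = least (λ m → iter f (suc m) x ≟ x) {p} eq

unique-concatMap : ∀ {A B : Set} (f : A → List B) {xs} → Unique xs → (∀ x → Unique (f x)) →
  (∀ x y {b} → b ∈ f x → b ∈ f y → x ≡ y) → Unique (concatMap f xs)
unique-concatMap f []       u d = []
unique-concatMap f {x ∷ xs} (p ∷ ps) u d = Uniq.++⁺ (u x) (unique-concatMap f ps u d)
  λ { (q , r) → disjoint q (find (∈-concatMap⁻ f {xs = xs} r)) }
  where
  disjoint : ∀ {b} → b ∈ f x → ∃ (λ y → y ∈ xs × b ∈ f y) → ⊥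
  disjoint q (y , y∈ , r) = All.lookup p y∈ (d x y q r)

tour : Marks → ℕ → Forest → List Word
tour S zero    t = segment⁻ S t
tour S (suc m) t = segment⁻ S t ++ top (next S t) ∷ tour S m (next S t)

tour-zigzag : ∀ S m t {k} → size t ≡ suc k →
  Zigzag _⋖_ lo lo (lower (word t)) (upper (second (turn (exchange S (iter (next S) m t))))) (tour S m t)
tour-zigzag S zero    t eq = segment-zigzag S t eq
tour-zigzag S (suc m) t eq = joinUp (segment-zigzag S t eq) (second⋖top (exchange S t) (trans (size-exchange S t) eq))
  (down flip (subst (λ u → Zigzag _⋖_ lo lo (lower (word (next S t))) (upper (second (turn (exchange S u))))
      (tour S m (next S t)))
    (iter-comm (next S) m t) (tour-zigzag S m (next S t) (trans (size-next S t) eq))))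

tour-segments : ∀ S m t →
  tour S m t ++ top (iter (next S) (suc m) t) ∷ [] ≡ concatMap (segment S) (iterate (next S) t (suc m))
tour-segments S zero    t = sym (++-identityʳ (segment S t))
tour-segments S (suc m) t = begin
  (segment⁻ S t ++ top t′ ∷ tour S m t′) ++ z ∷ []       ≡⟨ ++-assoc (segment⁻ S t) (top t′ ∷ tour S m t′) _ ⟩
  segment⁻ S t ++ top t′ ∷ (tour S m t′ ++ z ∷ [])       ≡⟨ ++-assoc (segment⁻ S t) (top t′ ∷ []) _ ⟨
  segment S t ++ (tour S m t′ ++ z ∷ [])
    ≡⟨ cong (λ x → segment S t ++ (tour S m t′ ++ top x ∷ [])) (iter-comm (next S) (suc m) t) ⟨
  segment S t ++ (tour S m t′ ++ top (iter (next S) (suc m) t′) ∷ []) ≡⟨ cong (segment S t ++_) (tour-segments S m t′) ⟩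
  segment S t ++ concatMap (segment S) (iterate (next S) t′ (suc m)) ∎
  where
  open ≡-Reasoning
  t′ = next S t
  z = top (iter (next S) (suc (suc m)) t)

-- The index is shifted: the words have length 2k + 3 and lie on the levels k + 1 and k + 2. The two
-- ends and the vertex kept apart turn into `z`, `final` and the closing chain.
record MiddleCycle (k : ℕ) : Set where
  field
    vertices : List Word
    zigzag   : Zigzag _⋖_ lo lo (lower (word (comb (suc k)))) (𝟏 ∷ 𝟎 ∷ 𝟎 ∷ reverse (word (comb k))) vertices
    distinct : Unique (vertices ++ top (comb (suc k)) ∷ [])
    spanning : ∀ w → length w ≡ suc (suc k + suc k) → ones w ≡ suc k ⊎ ones w ≡ suc (suc k) →
               w ∈ vertices ++ top (comb (suc k)) ∷ []

comb-snoc : ∀ k → comb k ⋆ node ε ε ≡ comb (suc k)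
comb-snoc zero    = refl
comb-snoc (suc k) = cong (node ε) (comb-snoc k)

module _ (k : ℕ) (S : Marks) (orbit : ∀ t → size t ≡ suc k → Reach (next S) (comb (suc k)) t)
         {p : ℕ} (period : iter (next S) (suc p) (comb (suc k)) ≡ comb (suc k))
         (minimal : ∀ {i} → i < p → iter (next S) (suc i) (comb (suc k)) ≢ comb (suc k)) where

  private
    z₀ : Forest
    z₀ = comb (suc k)

  segments : tour S p z₀ ++ top z₀ ∷ [] ≡ concatMap (segment S) (iterate (next S) z₀ (suc p))
  segments = trans (cong (λ x → tour S p z₀ ++ top x ∷ []) (sym period)) (tour-segments S p z₀)
  covered : ∀ {w} → (∃ λ t → size t ≡ suc k × w ∈ segment S t) → w ∈ concatMap (segment S) (iterate (next S) z₀ (suc p))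
  covered (t , eq , w∈) with orbit t eq
  ... | m , refl = ∈-concatMap⁺ (segment S) (lose
    (subst (_∈ iterate (next S) z₀ (suc p)) (iter-% (next S) period m) (∈-iterate⁺ (next S) z₀ (m%n<n m (suc p)))) w∈)
  -- Since `rotate` is injective, returning to `comb (suc k)` determines the tree before the last
  -- rotation, whatever the marks are.
  last-exchanged : exchange S (iter (next S) p z₀) ≡ node (comb k) ε
  last-exchanged = rotate-injective {exchange S (iter (next S) p z₀)} {node (comb k) ε}
    (trans period (sym (trans (rotate-node (comb k) ε) (comb-snoc k))))
  ending : upper (second (turn (exchange S (iter (next S) p z₀)))) ≡ 𝟏 ∷ 𝟎 ∷ 𝟎 ∷ reverse (word (comb k))
  ending = trans (cong (λ x → upper (second (turn x))) last-exchanged) (cong (λ x → 𝟏 ∷ 𝟎 ∷ 𝟎 ∷ x) (not-mirror (comb k)))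

  -- Minimality of the period keeps the segments distinct; the single orbit makes them exhaust both
  -- levels.
  orbit⇒middle-cycle : MiddleCycle k
  orbit⇒middle-cycle = record
    { vertices = tour S p z₀
    ; zigzag   = subst (λ x → Zigzag _⋖_ lo lo (lower (word z₀)) x (tour S p z₀)) ending
        (tour-zigzag S p z₀ (size-comb (suc k)))
    ; distinct = subst Unique (sym segments) (unique-concatMap (segment S)
        (iterate-unique (next S) (next-injective S) (suc p) (λ { (s≤s i<p) → minimal i<p }))
        (segment-unique S) (segment-disjoint S))
    ; spanning = λ w len h → subst (w ∈_) (sym segments) (covered (segments-cover S (suc k) w len h))
    }

middle-cycle : ∀ k → MiddleCycle k
middle-cycle k = on-orbit (single-orbit (suc k))
  where
  on-orbit : (∃ λ S → ∀ t → size t ≡ suc k → Reach (next S) (comb (suc k)) t) → MiddleCycle k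
  on-orbit (S , orbit) = go (least-period _≟ᶠ_ (next S) (next-periodic S (comb (suc k))))
    where
    go : (∃ λ p → iter (next S) (suc p) (comb (suc k)) ≡ comb (suc k) ×
            (∀ {i} → i < p → iter (next S) (suc i) (comb (suc k)) ≢ comb (suc k))) → MiddleCycle k
    go (p , period , minimal) = orbit⇒middle-cycle k S orbit period minimal

-- The closing chains

-- z n k is the word 0ⁿ⁻²ᵏ(01)ᵏ, and e n k i replaces its first i letters by 1; both are junk unless
-- i + 2k ≤ n.
mutual
  z : (n k : ℕ) → Subset n
  z zero    k = []
  z (suc n) k with k + k ≤? n
  ... | yes _ = 𝟎 ∷ z n k
  ... | no _  = 𝟎 ∷ e n (pred k) 1

  e : (n k i : ℕ) → Subset n
  e n       k zero    = z n k
  e zero    k (suc i) = []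
  e (suc n) k (suc i) = 𝟏 ∷ e n k i

z-pad : ∀ {n k} → k + k ≤ n → z (suc n) k ≡ 𝟎 ∷ z n k
z-pad {n} {k} p with k + k ≤? n
... | yes _ = refl
... | no ¬p = ⊥-elim (¬p p)

z-tight : ∀ {n} k → suc k + suc k ≡ suc n → z (suc n) (suc k) ≡ 𝟎 ∷ e n k 1
z-tight {n} k eq with suc k + suc k ≤? n
... | yes p = ⊥-elim (1+n≰n (subst (_≤ n) eq p))
... | no _  = refl

pad-or-tight : ∀ {n k} → suc k + suc k ≤ suc n → suc k + suc k ≤ n ⊎ suc k + suc k ≡ suc n
pad-or-tight p with m≤n⇒m<n∨m≡n p
... | inj₁ (s≤s q) = inj₁ q
... | inj₂ eq      = inj₂ eq

∣e∣ : ∀ n k i → i + (k + k) ≤ n → ∣ e n k i ∣ ≡ k + i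
∣e∣ zero    zero    zero    p = refl
∣e∣ (suc n) k       (suc i) (s≤s p) = trans (cong suc (∣e∣ n k i p)) (sym (+-suc k i))
∣e∣ (suc n) zero    zero    p = ∣e∣ n zero zero z≤n
∣e∣ (suc n) (suc k) zero    p with pad-or-tight {k = k} p
... | inj₁ q  rewrite z-pad {k = suc k} q = ∣e∣ n (suc k) zero q
... | inj₂ eq rewrite z-tight k eq = trans (∣e∣ n k 1 (≤-reflexive (trans (sym (+-suc k k)) (suc-injective eq)))) (+-suc k 0)

e-mono : ∀ n k i → suc i + (k + k) ≤ n → e n k i ⊆ e n k (suc i)
e-mono (suc n) k zero    (s≤s p) rewrite z-pad {k = k} p = out⊆ ⊆-refl
e-mono (suc n) k (suc i) (s≤s p) = s⊆s (e-mono n k i p)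

-- Only the last of the n - 2k leading zeros changes, to 1.
z-mono : ∀ n k → suc k + suc k ≤ n → z n k ⊆ z n (suc k)
z-mono (suc n) k p with pad-or-tight {k = k} p
... | inj₁ q rewrite z-pad {k = suc k} q | z-pad {n} {k} (≤-trans (+-mono-≤ (n≤1+n k) (n≤1+n k)) q) = s⊆s (z-mono n k q)
z-mono (suc zero)    k p | inj₂ eq = ⊥-elim (1+n≢0 (trans (sym (+-suc k k)) (suc-injective eq)))
z-mono (suc (suc n)) k p | inj₂ eq
  rewrite z-tight k eq
        | z-pad {suc n} {k} (≤-trans (n≤1+n (k + k)) (≤-reflexive (trans (sym (+-suc k k)) (suc-injective eq))))
        | z-pad {n} {k} (≤-reflexive (suc-injective (trans (sym (+-suc k k)) (suc-injective eq))))
  = s⊆s (out⊆ ⊆-refl)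

-- Walks between two types of vertices

data Walk {B T : Set} (_⟶_ : B → T → Set) : B → B → List B → List T → Set where
  stop : ∀ {b} → Walk _⟶_ b b (b ∷ []) []
  step : ∀ {b b′ c t bs ts} → b ⟶ t → b′ ⟶ t → Walk _⟶_ b′ c bs ts → Walk _⟶_ b c (b ∷ bs) (t ∷ ts)

module _ {B T : Set} {_⟶_ : B → T → Set} where

  walk-append : ∀ {b c b′ c′ t bs ts bs′ ts′} → Walk _⟶_ b c bs ts → c ⟶ t → b′ ⟶ t → Walk _⟶_ b′ c′ bs′ ts′ →
    Walk _⟶_ b c′ (bs ++ bs′) (ts ++ t ∷ ts′)
  walk-append stop         p q w = step p q w
  walk-append (step r s v) p q w = step r s (walk-append v p q w)

  walk-reverse : ∀ {b c bs ts} → Walk _⟶_ b c bs ts → Walk _⟶_ c b (reverse bs) (reverse ts)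
  walk-reverse stop = stop
  walk-reverse (step {b} {t = t} {bs = bs} {ts} p q w) rewrite unfold-reverse b bs | unfold-reverse t ts =
    walk-append (walk-reverse w) q p stop

module _ {B T B′ T′ : Set} {_⟶_ : B → T → Set} {_⟶′_ : B′ → T′ → Set} (f : B → B′) (g : T → T′)
         where

  walk-map : ∀ {b c bs ts} → (∀ {b t} → b ⟶ t → f b ⟶′ g t) →
    Walk _⟶_ b c bs ts → Walk _⟶′_ (f b) (f c) (map f bs) (map g ts)
  walk-map h stop         = stop
  walk-map h (step p q w) = step (h p) (h q) (walk-map h w)

-- Saturating cycles

-- Indexed by the cardinality of the sets; only the values at sizes k + 1, ..., l carry meaning.
Chain : ℕ → Set
Chain n = ℕ → Subset n

closing : (n k : ℕ) → Chain n
closing n k j = e n k (j ∸ k)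

-- For positive size this is 1 followed by the first set for one element less. The induction forces
-- it: the second half of a glued arrangement runs backwards and ends at its own first set.
final : (n k : ℕ) → Subset n
final n zero    = z n 0
final n (suc k) = e n k 1

at : ∀ {n} → ℕ → List (Chain n) → List (Subset n)
at j = map (λ c → c j)

record Meets {n} (k : ℕ) (b : Subset n) (c : Chain n) : Set where
  constructor meets
  field
    ⊆-first : b ⊆ c (suc k)

-- A cyclic sequence of all k-sets together with disjoint chains of sets of sizes k + 1, …, l = n - k,
-- one for each pair of consecutive k-sets and containing both; closing n k is the chain between the last
-- set and the first set. By chains-free, the closing chains of larger k′ avoid all chains.
record Saturating (n k l : ℕ) : Set where
  field
    sets   : List (Subset n)
    links  : List (Chain n)
    walk   : Walk (Meets k) (z n k) (final n k) sets links

  chains : List (Chain n)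
  chains = closing n k ∷ links

  field
    sets-card     : ∀ {b} → b ∈ sets → ∣ b ∣ ≡ k
    sets-cover    : ∀ b → ∣ b ∣ ≡ k → b ∈ sets
    sets-unique   : Unique sets
    chains-card   : ∀ {c j} → c ∈ chains → k < j → j ≤ l → ∣ c j ∣ ≡ j
    chains-mono   : ∀ {c j} → c ∈ chains → k < j → j < l → c j ⊆ c (suc j)
    chains-unique : ∀ {j} → k < j → j ≤ l → Unique (at j chains)
    chains-cover  : ∀ t → ∣ t ∣ ≡ l → t ∈ at l chains
    chains-free   : ∀ {k′ i} → k < k′ → i + (k′ + k′) ≤ n → e n k′ i ∉ at (k′ + i) chains

∣closing∣ : ∀ {n k l j} → n ≡ k + l → k < j → j ≤ l → ∣ closing n k j ∣ ≡ j
∣closing∣ {n} {k} {l} {j} n≡ k<j j≤l = trans (∣e∣ n k (j ∸ k) bound) (m+[n∸m]≡n (<⇒≤ k<j))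
  where
  bound : j ∸ k + (k + k) ≤ n
  bound = subst₂ _≤_ (trans (cong (_+ k) (sym (m∸n+n≡m (<⇒≤ k<j)))) (+-assoc (j ∸ k) k k)) (trans (+-comm l k) (sym n≡))
    (+-monoˡ-≤ k j≤l)

closing-mono : ∀ {n k l j} → n ≡ k + l → k < j → j < l → closing n k j ⊆ closing n k (suc j)
closing-mono {n} {k} {l} {j} n≡ k<j j<l rewrite +-∸-assoc 1 (<⇒≤ k<j) = e-mono n k (j ∸ k) bound
  where
  bound : suc (j ∸ k + (k + k)) ≤ n
  bound = subst₂ _≤_ (cong suc (trans (cong (_+ k) (sym (m∸n+n≡m (<⇒≤ k<j)))) (+-assoc (j ∸ k) k k)))
    (trans (+-comm l k) (sym n≡))
    (+-monoˡ-≤ k j<l)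

closing-start : ∀ n k → closing n k (suc k) ≡ e n k 1
closing-start n k = cong (e n k) (m+n∸n≡m 1 k)

final⊆closing : ∀ n k → suc (k + k) ≤ n → final n k ⊆ closing n k (suc k)
final⊆closing n       zero    p = e-mono n 0 0 p
final⊆closing (suc n) (suc k) (s≤s p) rewrite closing-start (suc n) (suc k) = s⊆s (z-mono n k p)

z⊆closing : ∀ n k → suc (k + k) ≤ n → z n k ⊆ closing n k (suc k)
z⊆closing n k p rewrite closing-start n k = e-mono n k 0 p

infix 4 _≟ˢ_

_≟ˢ_ : ∀ {n} → DecidableEquality (Subset n)
_≟ˢ_ = Vec.≡-dec Bool._≟_

tail-≡ : ∀ {n b b′} {p q : Subset n} → _≡_ {A = Subset (suc n)} (b ∷ p) (b′ ∷ q) → p ≡ q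
tail-≡ refl = refl

unique-map-injective : ∀ {A B : Set} (f : A → B) {xs x y} → Unique (map f xs) → x ∈ xs → y ∈ xs → f x ≡ f y → x ≡ y
unique-map-injective f _        (here refl) (here refl) _  = refl
unique-map-injective f (p ∷ _)  (here refl) (there y∈)  eq = ⊥-elim (All.lookup p (∈-map⁺ f y∈) eq)
unique-map-injective f (p ∷ _)  (there x∈)  (here refl) eq = ⊥-elim (All.lookup p (∈-map⁺ f x∈) (sym eq))
unique-map-injective f (_ ∷ ps) (there x∈)  (there y∈)  eq = unique-map-injective f ps x∈ y∈ eq

head∉tail : ∀ {A : Set} {x : A} {xs} → Unique (x ∷ xs) → x ∉ xs
head∉tail (p ∷ _) x∈ = All.lookup p x∈ refl

-- The set above 0v in its chain: 1v, unless 1v already continues a chain d of ds, which then cedes its last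
-- set d (suc l).
raise : ∀ {n} → List (Chain n) → ℕ → Subset n → Subset (suc n)
raise []       l v = 𝟏 ∷ v
raise (d ∷ ds) l v with v ≟ˢ d l
... | yes _ = 𝟎 ∷ d (suc l)
... | no _  = raise ds l v

data Raised {n} (ds : List (Chain n)) (l : ℕ) (v : Subset n) : Subset (suc n) → Set where
  fresh : v ∉ at l ds → Raised ds l v (𝟏 ∷ v)
  along : ∀ {d} → d ∈ ds → v ≡ d l → Raised ds l v (𝟎 ∷ d (suc l))

raised : ∀ {n} (ds : List (Chain n)) l v → Raised ds l v (raise ds l v)
raised []       l v = fresh λ ()
raised (d ∷ ds) l v with v ≟ˢ d l
... | yes eq = along (here refl) eq
... | no ≢d with raise ds l v | raised ds l v
...   | _ | fresh v∉      = fresh λ { (here eq) → ≢d eq ; (there p) → v∉ p }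
...   | _ | along d∈ eq   = along (there d∈) eq

raise-injective : ∀ {n} (ds : List (Chain n)) l → Unique (at (suc l) ds) → ∀ {v w} → raise ds l v ≡ raise ds l w → v ≡ w
raise-injective ds l u {v} {w} eq with raise ds l v | raised ds l v | raise ds l w | raised ds l w
... | _ | fresh _ | _ | fresh _ = tail-≡ eq
raise-injective ds l u () | _ | fresh _ | _ | along _ _
raise-injective ds l u () | _ | along _ _ | _ | fresh _
... | _ | along d∈ p | _ | along d′∈ q with unique-map-injective (λ c → c (suc l)) u d∈ d′∈ (tail-≡ eq)
...   | refl = trans p (sym q)

raise-along : ∀ {n} (ds : List (Chain n)) l → Unique (at l ds) → ∀ {d} → d ∈ ds → raise ds l (d l) ≡ 𝟎 ∷ d (suc l)
raise-along ds l u {d} d∈ with raise ds l (d l) | raised ds l (d l)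
... | _ | fresh d∉ = ⊥-elim (d∉ (∈-map⁺ (λ c → c l) d∈))
... | _ | along {d′} d′∈ p with unique-map-injective (λ c → c l) u d∈ d′∈ p
...   | refl = refl

raise-fresh : ∀ {n} (ds : List (Chain n)) l {v} → v ∉ at l ds → raise ds l v ≡ 𝟏 ∷ v
raise-fresh ds l {v} v∉ with raise ds l v | raised ds l v
... | _ | fresh _     = refl
... | _ | along d∈ refl = ⊥-elim (v∉ (∈-map⁺ (λ c → c l) d∈))

∣raise∣ : ∀ {n} (ds : List (Chain n)) l v → (∀ {d} → d ∈ ds → ∣ d (suc l) ∣ ≡ suc l) → ∣ v ∣ ≡ l → ∣ raise ds l v ∣ ≡ suc l
∣raise∣ ds l v h eq with raise ds l v | raised ds l v
... | _ | fresh _   = cong suc eq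
... | _ | along d∈ _ = h d∈

⊆-raise : ∀ {n} (ds : List (Chain n)) l v → (∀ {d} → d ∈ ds → d l ⊆ d (suc l)) → 𝟎 ∷ v ⊆ raise ds l v
⊆-raise ds l v h with raise ds l v | raised ds l v
... | _ | fresh _       = out⊆ ⊆-refl
... | _ | along d∈ refl = s⊆s (h d∈)

module Step {n k l : ℕ} (n≡ : n ≡ suc k + l) (k<l : suc k < l)
            (A : Saturating n (suc k) l) (B : Saturating n k (suc l)) where

  private
    module A = Saturating A
    module B = Saturating B

    n≡′ : n ≡ k + suc l
    n≡′ = trans n≡ (sym (+-suc k l))

    sucn≡ : suc n ≡ suc k + suc l
    sucn≡ = cong suc n≡′

    2k≤n : suc k + suc k ≤ n
    2k≤n = ≤-trans (+-monoʳ-≤ (suc k) (<⇒≤ k<l)) (≤-reflexive (sym n≡))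

    -- Prepending 1 raises sizes by one, so `above d` has `d l` at the new top, and `d (suc l)` is
    -- left over for some `below c`. The value of `above d` at zero is a dummy.
    below above : Chain n → Chain (suc n)
    below c j with j ≤? l
    ... | yes _ = 𝟎 ∷ c j
    ... | no _  = raise B.chains l (c l)
    above d zero    = 𝟏 ∷ d zero
    above d (suc j) = 𝟏 ∷ d j

    below-≤ : ∀ c {j} → j ≤ l → below c j ≡ 𝟎 ∷ c j
    below-≤ c {j} p with j ≤? l
    ... | yes _ = refl
    ... | no ¬p = ⊥-elim (¬p p)

    below-top : ∀ c → below c (suc l) ≡ raise B.chains l (c l)
    below-top c with suc l ≤? l
    ... | yes p = ⊥-elim (1+n≰n p)
    ... | no _  = refl

    closing-suc : ∀ {j} → suc k ≤ j → closing (suc n) (suc k) (suc j) ≡ 𝟏 ∷ closing n (suc k) j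
    closing-suc {suc j} (s≤s p) rewrite +-∸-assoc 1 p = refl

    -- The instance of `chains-free` for which that field is carried along: it keeps the new closing
    -- chain, which is the old one of `A` behind a 1, off the chains that come from `B`.
    closing-free : ∀ {j} → suc k ≤ j → j ≤ l → closing n (suc k) j ∉ at j B.chains
    closing-free {j} p q = subst (λ m → closing n (suc k) j ∉ at m B.chains) (m+[n∸m]≡n p) (B.chains-free ≤-refl bound)
      where
      bound : j ∸ suc k + (suc k + suc k) ≤ n
      bound = subst₂ _≤_ (trans (cong (_+ suc k) (sym (m∸n+n≡m p))) (+-assoc (j ∸ suc k) (suc k) (suc k)))
        (trans (+-comm l (suc k)) (sym n≡)) (+-monoˡ-≤ (suc k) q)

    sets′ : List (Subset (suc n))
    sets′ = map (𝟎 ∷_) A.sets ++ reverse (map (𝟏 ∷_) B.sets)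

    -- The closing chain of `B` bridges the two halves, and that of `A` is absent because it becomes
    -- the new closing chain.
    links′ : List (Chain (suc n))
    links′ = map below A.links ++ above (closing n k) ∷ reverse (map above B.links)

    chains′ : List (Chain (suc n))
    chains′ = closing (suc n) (suc k) ∷ links′

    walk′ : Walk (Meets (suc k)) (z (suc n) (suc k)) (final (suc n) (suc k)) sets′ links′
    walk′ = subst (λ x → Walk (Meets (suc k)) x (final (suc n) (suc k)) sets′ links′) (sym (z-pad {k = suc k} 2k≤n))
      (walk-append
        (walk-map (𝟎 ∷_) below (λ { {b} {c} (meets p) → meets (subst (𝟎 ∷ b ⊆_) (sym (below-≤ c k<l)) (s⊆s p)) }) A.walk)
        (meets (out⊆ (⊆-reflexive (sym (closing-start n k)))))
        (meets (s⊆s (final⊆closing n k (≤-trans (≤-trans (≤-reflexive (sym (+-suc k k))) (n≤1+n _)) 2k≤n))))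
        (walk-reverse (walk-map (𝟏 ∷_) above (λ { (meets p) → meets (s⊆s p) }) B.walk)))

    sets-↭ : sets′ ↭ map (𝟎 ∷_) A.sets ++ map (𝟏 ∷_) B.sets
    sets-↭ = ++⁺ˡ-↭ (map (𝟎 ∷_) A.sets) (↭-reverse (map (𝟏 ∷_) B.sets))

    chains-↭ : chains′ ↭ closing (suc n) (suc k) ∷ map below A.links ++ map above B.chains
    chains-↭ = ↭-prep _ (++⁺ˡ-↭ (map below A.links) (↭-prep _ (↭-reverse (map above B.links))))

    data InSets : Subset (suc n) → Set where
      low  : ∀ {b} → b ∈ A.sets → InSets (𝟎 ∷ b)
      high : ∀ {b} → b ∈ B.sets → InSets (𝟏 ∷ b)

    inSets : ∀ {b} → b ∈ sets′ → InSets b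
    inSets p with ∈-++⁻ (map (𝟎 ∷_) A.sets) (∈-resp-↭ sets-↭ p)
    ... | inj₁ q with ∈-map⁻ (𝟎 ∷_) q
    ...   | _ , b∈ , refl = low b∈
    inSets p | inj₂ q with ∈-map⁻ (𝟏 ∷_) q
    ...   | _ , b∈ , refl = high b∈

    data InChains : Chain (suc n) → Set where
      close : InChains (closing (suc n) (suc k))
      low   : ∀ {c} → c ∈ A.links → InChains (below c)
      high  : ∀ {d} → d ∈ B.chains → InChains (above d)

    inChains : ∀ {c} → c ∈ chains′ → InChains c
    inChains p with ∈-resp-↭ chains-↭ p
    ... | here refl = close
    ... | there q with ∈-++⁻ (map below A.links) q
    ...   | inj₁ r with ∈-map⁻ below r
    ...     | _ , c∈ , refl = low c∈
    inChains p | there q | inj₂ r with ∈-map⁻ above r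
    ...     | _ , d∈ , refl = high d∈

    card′ : ∀ {b} → InSets b → ∣ b ∣ ≡ suc k
    card′ (low b∈)  = A.sets-card b∈
    card′ (high b∈) = cong suc (B.sets-card b∈)

    cover′ : ∀ b → ∣ b ∣ ≡ suc k → b ∈ sets′
    cover′ (𝟎 ∷ b) eq = ∈-resp-↭ (↭-sym sets-↭) (∈-++⁺ˡ (∈-map⁺ (𝟎 ∷_) (A.sets-cover b eq)))
    cover′ (𝟏 ∷ b) eq = ∈-resp-↭ (↭-sym sets-↭)
      (∈-++⁺ʳ (map (𝟎 ∷_) A.sets) (∈-map⁺ (𝟏 ∷_) (B.sets-cover b (suc-injective eq))))

    heads-differ : ∀ {m} {ps qs : List (Subset m)} {v} → ¬ (v ∈ map (𝟎 ∷_) ps × v ∈ map (𝟏 ∷_) qs)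
    heads-differ (p , q) with ∈-map⁻ (𝟎 ∷_) p | ∈-map⁻ (𝟏 ∷_) q
    ... | _ , _ , refl | _ , _ , ()

    unique′ : Unique sets′
    unique′ = Unique-resp-↭ (↭-sym sets-↭) (Uniq.++⁺ (Uniq.map⁺ tail-≡ A.sets-unique) (Uniq.map⁺ tail-≡ B.sets-unique) heads-differ)

    chains-card′ : ∀ {c j} → InChains c → suc k < j → j ≤ suc l → ∣ c j ∣ ≡ j
    chains-card′ close p q = ∣closing∣ sucn≡ p q
    chains-card′ (high d∈) (s≤s p) (s≤s q) = cong suc (B.chains-card d∈ p (m≤n⇒m≤1+n q))
    chains-card′ {j = j} (low {c} c∈) p q with m≤n⇒m<n∨m≡n q
    ... | inj₁ (s≤s j≤l) = trans (cong ∣_∣ (below-≤ c j≤l)) (A.chains-card (there c∈) p j≤l)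
    ... | inj₂ refl = trans (cong ∣_∣ (below-top c)) (∣raise∣ B.chains l (c l)
            (λ d∈ → B.chains-card d∈ (≤-trans (≤-trans (n≤1+n _) k<l) (n≤1+n l)) ≤-refl) (A.chains-card (there c∈) k<l ≤-refl))

    chains-mono′ : ∀ {c j} → InChains c → suc k < j → j < suc l → c j ⊆ c (suc j)
    chains-mono′ close p q = closing-mono sucn≡ p q
    chains-mono′ (high d∈) (s≤s p) (s≤s q) = s⊆s (B.chains-mono d∈ p (s≤s (≤-trans (n≤1+n _) q)))
    chains-mono′ {j = j} (low {c} c∈) p (s≤s q) with m≤n⇒m<n∨m≡n q
    ... | inj₁ j<l = subst₂ _⊆_ (sym (below-≤ c q)) (sym (below-≤ c j<l)) (s⊆s (A.chains-mono (there c∈) p j<l))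
    ... | inj₂ refl = subst₂ _⊆_ (sym (below-≤ c q)) (sym (below-top c)) (⊆-raise B.chains l (c l)
            (λ d∈ → B.chains-mono d∈ (≤-trans (n≤1+n _) k<l) ≤-refl))

    at-↭ : ∀ {j xs} → suc k ≤ j → at (suc j) (map below A.links) ≡ xs →
           at (suc j) chains′ ↭ (𝟏 ∷ closing n (suc k) j) ∷ xs ++ map (𝟏 ∷_) (at j B.chains)
    at-↭ {j} {xs} p eq = ↭-trans (map⁺ (λ c → c (suc j)) chains-↭) (↭-reflexive (cong₂ _∷_ (closing-suc p)
      (trans (map-++ (λ c → c (suc j)) (map below A.links) (map above B.chains))
        (cong₂ _++_ eq (trans (sym (map-∘ B.chains)) (map-∘ B.chains))))))

    at-low : ∀ {j} → suc k ≤ j → suc j ≤ l →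
             at (suc j) chains′ ↭ (𝟏 ∷ closing n (suc k) j) ∷ map (𝟎 ∷_) (at (suc j) A.links) ++ map (𝟏 ∷_) (at j B.chains)
    at-low p q = at-↭ p (trans (sym (map-∘ A.links)) (trans (map-cong (λ c → below-≤ c q) A.links) (map-∘ A.links)))

    at-top : at (suc l) chains′ ↭ (𝟏 ∷ closing n (suc k) l) ∷ map (raise B.chains l) (at l A.links) ++ map (𝟏 ∷_) (at l B.chains)
    at-top = at-↭ (<⇒≤ k<l) (trans (sym (map-∘ A.links)) (trans (map-cong below-top A.links) (map-∘ A.links)))

    not-above : ∀ {j} → suc k ≤ j → j ≤ l → 𝟏 ∷ closing n (suc k) j ∉ map (𝟏 ∷_) (at j B.chains)
    not-above p q r with ∈-map⁻ (𝟏 ∷_) r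
    ... | _ , v∈ , eq = closing-free p q (subst (_∈ at _ B.chains) (sym (tail-≡ eq)) v∈)

    unique-low : ∀ {j} → suc k ≤ j → suc j ≤ l → Unique (at (suc j) chains′)
    unique-low {j} p q = Unique-resp-↭ (↭-sym (at-low p q)) (∉⇒All close∉ ∷ Uniq.++⁺
      (Uniq.map⁺ tail-≡ (unique-++ʳ (closing n (suc k) (suc j) ∷ []) (A.chains-unique (s≤s p) q)))
      (Uniq.map⁺ tail-≡ (B.chains-unique p (≤-trans (n≤1+n j) (≤-trans q (n≤1+n l))))) heads-differ)
      where
      close∉ : 𝟏 ∷ closing n (suc k) j ∉ map (𝟎 ∷_) (at (suc j) A.links) ++ map (𝟏 ∷_) (at j B.chains)
      close∉ r with ∈-++⁻ (map (𝟎 ∷_) (at (suc j) A.links)) r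
      ... | inj₂ s = not-above p (≤-trans (n≤1+n j) q) s
      ... | inj₁ s with ∈-map⁻ (𝟎 ∷_) s
      ...   | _ , _ , ()

    unique-top : Unique (at (suc l) chains′)
    unique-top = Unique-resp-↭ (↭-sym at-top) (∉⇒All close∉ ∷ Uniq.++⁺
      (Uniq.map⁺ (raise-injective B.chains l (B.chains-unique (≤-trans (n≤1+n _) (m≤n⇒m≤1+n k<l)) ≤-refl))
        (unique-++ʳ (closing n (suc k) l ∷ []) (A.chains-unique k<l ≤-refl)))
      (Uniq.map⁺ tail-≡ (B.chains-unique (≤-trans (n≤1+n _) k<l) (n≤1+n l))) disjoint)
      where
      disjoint : ∀ {v} → ¬ (v ∈ map (raise B.chains l) (at l A.links) × v ∈ map (𝟏 ∷_) (at l B.chains))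
      disjoint (p , q) with ∈-map⁻ (raise B.chains l) p | ∈-map⁻ (𝟏 ∷_) q
      ... | v , _ , eq | w , w∈ , refl with raise B.chains l v | raised B.chains l v
      disjoint (p , q) | v , _ , refl | .v , w∈ , refl | _ | fresh v∉ = v∉ w∈
      disjoint (p , q) | v , _ , ()   | w , w∈ , refl | _ | along _ _
      close∉ : 𝟏 ∷ closing n (suc k) l ∉ map (raise B.chains l) (at l A.links) ++ map (𝟏 ∷_) (at l B.chains)
      close∉ r with ∈-++⁻ (map (raise B.chains l) (at l A.links)) r
      ... | inj₂ s = not-above (<⇒≤ k<l) ≤-refl s
      ... | inj₁ s with ∈-map⁻ (raise B.chains l) s
      ...   | v , v∈ , eq with raise B.chains l v | raised B.chains l v
      ...     | _ | fresh _ = head∉tail (A.chains-unique k<l ≤-refl) (subst (_∈ at l A.links) (sym (tail-≡ eq)) v∈)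
      close∉ r | inj₁ s | v , v∈ , () | _ | along _ _

    chains-unique′ : ∀ {j} → suc k < j → j ≤ suc l → Unique (at j chains′)
    chains-unique′ (s≤s p) q with m≤n⇒m<n∨m≡n q
    ... | inj₁ (s≤s j≤l) = unique-low p j≤l
    ... | inj₂ refl      = unique-top

    chains-cover′ : ∀ t → ∣ t ∣ ≡ suc l → t ∈ at (suc l) chains′
    chains-cover′ t eq = ∈-resp-↭ (↭-sym at-top) (go t eq)
      where
      tops : List (Subset (suc n))
      tops = map (raise B.chains l) (at l A.links)
      raised∈ : ∀ {v} → v ∈ at l A.links → raise B.chains l v ∈ (𝟏 ∷ closing n (suc k) l) ∷ tops ++ map (𝟏 ∷_) (at l B.chains)
      raised∈ v∈ = there (∈-++⁺ˡ (∈-map⁺ (raise B.chains l) v∈))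
      open import Data.List.Membership.DecPropositional (_≟ˢ_ {n}) using (_∈?_)
      go : ∀ t → ∣ t ∣ ≡ suc l → t ∈ (𝟏 ∷ closing n (suc k) l) ∷ tops ++ map (𝟏 ∷_) (at l B.chains)
      go (𝟏 ∷ t) eq with t ∈? at l B.chains
      ... | yes t∈ = there (∈-++⁺ʳ tops (∈-map⁺ (𝟏 ∷_) t∈))
      ... | no t∉ with A.chains-cover t (suc-injective eq)
      ...   | here refl = here refl
      ...   | there t∈  = subst (_∈ _) (raise-fresh B.chains l t∉) (raised∈ t∈)
      -- Some chain `d` of `B` ends in `t`. Its set `d l` is the top of a chain of `A`, not of the
      -- closing one by `closing-free`, and `raise` continues that chain to 0t.
      go (𝟎 ∷ t) eq with ∈-map⁻ (λ c → c (suc l)) {xs = B.chains} (B.chains-cover t eq)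
      ... | d , d∈ , refl with A.chains-cover (d l) (B.chains-card d∈ (≤-trans (n≤1+n _) k<l) (n≤1+n l))
      ...   | here eq′ = ⊥-elim (closing-free (<⇒≤ k<l) ≤-refl (subst (_∈ at l B.chains) eq′ (∈-map⁺ (λ c → c l) d∈)))
      ...   | there d∈′ = subst (_∈ _) (raise-along B.chains l (B.chains-unique (≤-trans (n≤1+n _) k<l) (n≤1+n l)) d∈) (raised∈ d∈′)

    chains-free′ : ∀ {k′ i} → suc k < k′ → i + (k′ + k′) ≤ suc n → e (suc n) k′ i ∉ at (k′ + i) chains′
    chains-free′ {suc k′} {i} (s≤s k<k′) p r = go i p (∈-resp-↭ (at-low (≤-trans k<k′ (m≤m+n k′ i)) j≤l) r)
      where
      -- Sets of larger closing chains have size at most `l`, so the new top level, where `raise`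
      -- acts, is not concerned.
      j≤l : suc (k′ + i) ≤ l
      j≤l = +-cancelˡ-≤ (suc k′) _ _ (≤-trans
        (≤-reflexive (trans (sym (+-assoc (suc k′) (suc k′) i)) (+-comm (suc k′ + suc k′) i)))
        (≤-trans p (≤-trans (≤-reflexive (cong suc n≡)) (+-monoˡ-≤ l (s≤s k<k′)))))
      go : ∀ i → i + (suc k′ + suc k′) ≤ suc n → e (suc n) (suc k′) i ∉
           (𝟏 ∷ closing n (suc k) (k′ + i)) ∷ map (𝟎 ∷_) (at (suc (k′ + i)) A.links) ++ map (𝟏 ∷_) (at (k′ + i) B.chains)
      go (suc i) (s≤s p) (here eq) = A.chains-free (s≤s k<k′) p (here (trans (tail-≡ eq) (cong (closing n (suc k)) (+-suc k′ i))))
      go (suc i) (s≤s p) (there r) with ∈-++⁻ (map (𝟎 ∷_) (at (suc (k′ + suc i)) A.links)) r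
      ... | inj₁ q with ∈-map⁻ (𝟎 ∷_) q
      ...   | _ , _ , ()
      go (suc i) (s≤s p) (there r) | inj₂ q with ∈-map⁻ (𝟏 ∷_) q
      ...   | _ , v∈ , eq = B.chains-free (m≤n⇒m≤1+n k<k′) p
                (subst₂ (λ v m → v ∈ at m B.chains) (sym (tail-≡ eq)) (+-suc k′ i) v∈)
      go zero p r with pad-or-tight {k = k′} p
      go zero p r | inj₁ q rewrite z-pad {k = suc k′} q with r
      ... | there r′ with ∈-++⁻ (map (𝟎 ∷_) (at (suc (k′ + 0)) A.links)) r′
      ...   | inj₁ s with ∈-map⁻ (𝟎 ∷_) s
      ...     | _ , v∈ , eq = A.chains-free (s≤s k<k′) q (there (subst (_∈ at (suc (k′ + 0)) A.links) (sym (tail-≡ eq)) v∈))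
      go zero p r | inj₁ q | there r′ | inj₂ s with ∈-map⁻ (𝟏 ∷_) s
      ...     | _ , _ , ()
      go zero p r | inj₂ tight rewrite z-tight k′ tight with r
      ... | there r′ with ∈-++⁻ (map (𝟎 ∷_) (at (suc (k′ + 0)) A.links)) r′
      ...   | inj₂ s with ∈-map⁻ (𝟏 ∷_) s
      ...     | _ , _ , ()
      go zero p r | inj₂ tight | there r′ | inj₁ s with ∈-map⁻ (𝟎 ∷_) s
      ...     | v , v∈ , eq = tight-case (m≤n⇒m<n∨m≡n k<k′)
                (subst₂ (λ v m → v ∈ at m A.links) (sym (tail-≡ eq)) (cong suc (+-identityʳ k′)) v∈)
        where
        -- Without padding, the set is 0 followed by a set of the closing chain for `k′`, one less
        -- than before. Either `chains-free` for `A` still applies, or this is the closing chain of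
        -- `A` itself, which is disjoint from its links.
        tight-case : suc k < k′ ⊎ suc k ≡ k′ → e n k′ 1 ∉ at (suc k′) A.links
        tight-case (inj₁ q) r = A.chains-free {k′} {1} q
          (≤-reflexive (trans (sym (+-suc k′ k′)) (suc-injective tight)))
          (there (subst (λ m → e n k′ 1 ∈ at m A.links) (sym (+-comm k′ 1)) r))
        tight-case (inj₂ refl) r = head∉tail (A.chains-unique ≤-refl k<l)
          (subst (_∈ at (suc (suc k)) A.links) (sym (closing-start n (suc k))) r)

  step-saturating : Saturating (suc n) (suc k) (suc l)
  step-saturating = record
    { sets = sets′ ; links = links′ ; walk = walk′
    ; sets-card = λ b∈ → card′ (inSets b∈)
    ; sets-cover = cover′
    ; sets-unique = unique′
    ; chains-card = λ c∈ → chains-card′ (inChains c∈)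
    ; chains-mono = λ c∈ → chains-mono′ (inChains c∈)
    ; chains-unique = chains-unique′
    ; chains-cover = chains-cover′
    ; chains-free = chains-free′
    }

-- Base cases

z-zero : ∀ n (b : Subset n) → ∣ b ∣ ≡ 0 → b ≡ z n 0
z-zero zero    []      _  = refl
z-zero (suc n) (𝟎 ∷ b) eq = trans (cong (𝟎 ∷_) (z-zero n b eq)) (sym (z-pad {n} {0} z≤n))

e-full : ∀ n (t : Subset n) → ∣ t ∣ ≡ n → t ≡ e n 0 n
e-full zero    []      _  = refl
e-full (suc n) (𝟏 ∷ t) eq = cong (𝟏 ∷_) (e-full n t (suc-injective eq))
e-full (suc n) (𝟎 ∷ t) eq = ⊥-elim (1+n≰n (subst (_≤ n) eq (∣p∣≤n t)))

-- The left word has a 0 right after its first `i` letters, where the right word still has a 1.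
e-free₀ : ∀ n k i → i + (suc k + suc k) ≤ n → e n (suc k) i ≢ e n 0 (suc k + i)
e-free₀ (suc n) k (suc i) (s≤s p) eq = e-free₀ n k i p (trans (tail-≡ eq) (cong (e n 0) (+-suc k i)))
e-free₀ (suc n) k zero    p       eq with pad-or-tight {k = k} p
... | inj₁ q rewrite z-pad {k = suc k} q with eq
...   | ()
e-free₀ (suc n) k zero    p       eq | inj₂ tight rewrite z-tight k tight with eq
...   | ()

-- The cycle degenerates to the empty set, and the closing chain, which climbs to the full set,
-- leads from it back to it.
saturating-zero : ∀ l → 0 < l → Saturating l 0 l
saturating-zero l 0<l = record
  { sets = z l 0 ∷ [] ; links = [] ; walk = stop
  ; sets-card     = λ { (here refl) → ∣e∣ l 0 0 z≤n }
  ; sets-cover    = λ b eq → here (z-zero l b eq)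
  ; sets-unique   = [] ∷ []
  ; chains-card   = λ { (here refl) → ∣closing∣ refl }
  ; chains-mono   = λ { (here refl) → closing-mono refl }
  ; chains-unique = λ _ _ → [] ∷ []
  ; chains-cover  = λ t eq → here (e-full l t eq)
  ; chains-free   = λ { {suc k} {i} _ p (here eq) → e-free₀ l k i p eq }
  }

-- Words as subsets, and the middle levels as a base case

vec : ∀ n → Word → Subset n
vec zero    _       = []
vec (suc n) []      = 𝟎 ∷ vec n []
vec (suc n) (b ∷ w) = b ∷ vec n w

∣vec∣ : ∀ {n} w → length w ≡ n → ∣ vec n w ∣ ≡ ones w
∣vec∣ []      refl = refl
∣vec∣ (𝟏 ∷ w) refl = cong suc (∣vec∣ w refl)
∣vec∣ (𝟎 ∷ w) refl = ∣vec∣ w refl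

vec-injective : ∀ {n} v w → length v ≡ n → length w ≡ n → vec n v ≡ vec n w → v ≡ w
vec-injective []      []      refl _  _  = refl
vec-injective []      (_ ∷ _) refl () _
vec-injective (b ∷ v) (c ∷ w) refl p  eq = cong₂ _∷_ (Vec.∷-injectiveˡ eq)
  (vec-injective v w refl (suc-injective p) (Vec.∷-injectiveʳ eq))

vec-toList : ∀ {n} (p : Subset n) → vec n (toList p) ≡ p
vec-toList []      = refl
vec-toList (b ∷ p) = cong (b ∷_) (vec-toList p)

ones-toList : ∀ {n} (p : Subset n) → ones (toList p) ≡ ∣ p ∣
ones-toList []      = refl
ones-toList (𝟏 ∷ p) = cong suc (ones-toList p)
ones-toList (𝟎 ∷ p) = ones-toList p

vec-⊆ : ∀ n {v w} → v ⋖ w → vec n v ⊆ vec n w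
vec-⊆ zero    _         = ⊆-refl
vec-⊆ (suc n) flip      = out⊆ ⊆-refl
vec-⊆ (suc n) (later p) = s⊆s (vec-⊆ n p)

word-comb : ∀ k → reverse (word (comb (suc k))) ≡ 𝟎 ∷ 𝟏 ∷ reverse (word (comb k))
word-comb k = trans (cong (reverse ∘ word) (sym (comb-snoc k)))
  (trans (cong reverse (word-⋆ (comb k) (node ε ε))) (reverse-++ (word (comb k)) (𝟏 ∷ 𝟎 ∷ [])))

vec-comb : ∀ n k → n ≡ k + k → vec n (reverse (word (comb k))) ≡ z n k
vec-comb zero          zero    _  = refl
vec-comb (suc (suc n)) (suc k) eq rewrite word-comb k | z-tight k (sym eq) =
  cong (λ p → 𝟎 ∷ 𝟏 ∷ p) (vec-comb n k (suc-injective (trans (suc-injective eq) (+-suc k k))))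
vec-comb (suc zero)    (suc k) eq = ⊥-elim (1+n≢0 (sym (trans (suc-injective eq) (+-suc k k))))

zigzag⇒walk : ∀ {A : Set} {_<·_ : A → A → Set} {a b l} → Zigzag _<·_ lo lo a b l →
  ∃₂ λ bs ts → Walk _<·_ a b bs ts × l ↭ bs ++ ts
zigzag⇒walk stop = _ , _ , stop , ↭-refl
zigzag⇒walk (up {a = a} p (down {a = t} q y)) with zigzag⇒walk y
... | bs , ts , w , l↭ = a ∷ bs , t ∷ ts , step p q w , ↭-prep a (↭-trans (↭-prep t l↭) (↭-sym (shift t bs ts)))

walk-sets : ∀ {a b bs ts} → Walk _⋖_ a b bs ts → ∀ {x} → x ∈ bs → length x ≡ length a × ones x ≡ ones a
walk-sets stop         (here refl) = refl , refl
walk-sets (step p q w) (here refl) = refl , refl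
walk-sets (step p q w) (there x∈)  with walk-sets w x∈
... | len , one = trans len (trans (⋖-length q) (sym (⋖-length p))) , trans one (suc-injective (trans (sym (⋖-ones q)) (⋖-ones p)))

walk-tops : ∀ {a b bs ts} → Walk _⋖_ a b bs ts → ∀ {x} → x ∈ ts → length x ≡ length a × ones x ≡ suc (ones a)
walk-tops (step p q w) (here refl) = sym (⋖-length p) , ⋖-ones p
walk-tops (step p q w) (there x∈)  with walk-tops w x∈
... | len , one = trans len (trans (⋖-length q) (sym (⋖-length p))) , trans one (trans (sym (⋖-ones q)) (⋖-ones p))

unique-map-on : ∀ {A B : Set} (f : A → B) {xs} → (∀ {x y} → x ∈ xs → y ∈ xs → f x ≡ f y → x ≡ y) →
  Unique xs → Unique (map f xs)
unique-map-on f inj []       = []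
unique-map-on f {x ∷ xs} inj (p ∷ ps) = ∉⇒All fx∉ ∷ unique-map-on f (λ x∈ y∈ → inj (there x∈) (there y∈)) ps
  where
  fx∉ : f x ∉ map f xs
  fx∉ q with ∈-map⁻ f q
  ... | y , y∈ , eq = All.lookup p y∈ (inj (here refl) (there y∈) eq)

module Middle (k : ℕ) (M : MiddleCycle k) where

  open MiddleCycle M

  private
    k⁺ n : ℕ
    k⁺ = suc k
    n = suc (k⁺ + k⁺)

    t₀ : Word
    t₀ = top (comb k⁺)

    bs ts : List Word
    bs = proj₁ (zigzag⇒walk zigzag)
    ts = proj₁ (proj₂ (zigzag⇒walk zigzag))

    w : Walk _⋖_ (lower (word (comb k⁺))) (𝟏 ∷ 𝟎 ∷ 𝟎 ∷ reverse (word (comb k))) bs ts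
    w = proj₁ (proj₂ (proj₂ (zigzag⇒walk zigzag)))

    all-↭ : vertices ++ t₀ ∷ [] ↭ bs ++ (t₀ ∷ ts)
    all-↭ = ↭-trans (++⁺ʳ-↭ (t₀ ∷ []) (proj₂ (proj₂ (proj₂ (zigzag⇒walk zigzag)))))
      (↭-trans (++-assoc-↭ bs ts (t₀ ∷ [])) (++⁺ˡ-↭ bs (↭-sym (∷↭∷ʳ t₀ ts))))

    all-unique : Unique (bs ++ (t₀ ∷ ts))
    all-unique = Unique-resp-↭ all-↭ distinct

    ones-start : ones (lower (word (comb k⁺))) ≡ k⁺
    ones-start = trans (ones-reverse (word (comb k⁺))) (trans (ones-word (comb k⁺)) (size-comb k⁺))

    length-start : length (lower (word (comb k⁺))) ≡ n
    length-start = cong suc (trans (length-reverse (word (comb k⁺)))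
      (trans (length-word (comb k⁺)) (cong₂ _+_ (size-comb k⁺) (size-comb k⁺))))

    bs-facts : ∀ {x} → x ∈ bs → length x ≡ n × ones x ≡ k⁺
    bs-facts x∈ with walk-sets w x∈
    ... | p , q = trans p length-start , trans q ones-start

    ts-facts : ∀ {x} → x ∈ t₀ ∷ ts → length x ≡ n × ones x ≡ suc k⁺
    ts-facts (here refl) = length-start , cong suc ones-start
    ts-facts (there x∈) with walk-tops w x∈
    ... | p , q = trans p length-start , trans q (cong suc ones-start)

    locate : ∀ (p : Subset n) → ∣ p ∣ ≡ k⁺ ⊎ ∣ p ∣ ≡ suc k⁺ → toList p ∈ bs ⊎ toList p ∈ t₀ ∷ ts
    locate p h = ∈-++⁻ bs (∈-resp-↭ all-↭ (spanning (toList p) (length-toList p)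
      (subst (λ m → m ≡ k⁺ ⊎ m ≡ suc k⁺) (sym (ones-toList p)) h)))

    -- Between adjacent levels a chain is a single set, so its index carries no information.
    const-chain : Word → Chain n
    const-chain t _ = vec n t

    links′ : List (Chain n)
    links′ = map const-chain ts

    start≡ : vec n (lower (word (comb k⁺))) ≡ z n k⁺
    start≡ = trans (cong (𝟎 ∷_) (vec-comb (k⁺ + k⁺) k⁺ refl)) (sym (z-pad {k = k⁺} ≤-refl))

    final≡ : vec n (𝟏 ∷ 𝟎 ∷ 𝟎 ∷ reverse (word (comb k))) ≡ final n k⁺
    final≡ = cong (𝟏 ∷_) (go (k⁺ + k⁺) (cong suc (+-suc k k)))
      where
      go : ∀ m → m ≡ suc (suc (k + k)) → vec m (𝟎 ∷ 𝟎 ∷ reverse (word (comb k))) ≡ z m k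
      go m refl rewrite z-pad {suc (k + k)} {k} (n≤1+n _) | z-pad {k + k} {k} ≤-refl =
        cong (λ p → 𝟎 ∷ 𝟎 ∷ p) (vec-comb (k + k) k refl)

    top≡ : vec n t₀ ≡ closing n k⁺ (suc k⁺)
    top≡ = trans (cong (𝟏 ∷_) (vec-comb (k⁺ + k⁺) k⁺ refl)) (sym (closing-start n k⁺))

    at-top : at (suc k⁺) (closing n k⁺ ∷ links′) ≡ map (vec n) (t₀ ∷ ts)
    at-top = cong₂ _∷_ (sym top≡) (sym (map-∘ ts))

    squeeze : ∀ {j} → k⁺ < j → j ≤ suc k⁺ → j ≡ suc k⁺
    squeeze p q = ≤-antisym q p

  middle-saturating : Saturating n k⁺ (suc k⁺)
  middle-saturating = record
    { sets  = map (vec n) bs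
    ; links = links′
    ; walk  = subst₂ (λ x y → Walk (Meets k⁺) x y (map (vec n) bs) links′) start≡ final≡
                (walk-map (vec n) const-chain (λ p → meets (vec-⊆ n p)) w)
    ; sets-card     = sets-card′
    ; sets-cover    = sets-cover′
    ; sets-unique   = unique-map-on (vec n)
        (λ x∈ y∈ → vec-injective _ _ (proj₁ (bs-facts x∈)) (proj₁ (bs-facts y∈))) (unique-++ˡ bs all-unique)
    ; chains-card   = chains-card′
    ; chains-mono   = λ _ p q → ⊥-elim (<⇒≱ q p)
    ; chains-unique = λ p q → chains-unique′ (squeeze p q)
    ; chains-cover  = chains-cover′
    -- Vacuous: a larger `k′` would need 2k′ ≤ n, but `n` is only twice `k⁺` plus one.
    ; chains-free   = λ {k′} {i} p q → ⊥-elim (<⇒≱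
        (≤-trans (≤-reflexive (cong suc (sym (+-suc k⁺ k⁺)))) (+-mono-≤ p p)) (≤-trans (m≤n+m _ i) q))
    }
    where
    sets-card′ : ∀ {b} → b ∈ map (vec n) bs → ∣ b ∣ ≡ k⁺
    sets-card′ b∈ with ∈-map⁻ (vec n) b∈
    ... | x , x∈ , refl = trans (∣vec∣ x (proj₁ (bs-facts x∈))) (proj₂ (bs-facts x∈))
    sets-cover′ : ∀ b → ∣ b ∣ ≡ k⁺ → b ∈ map (vec n) bs
    sets-cover′ b eq with locate b (inj₁ eq)
    ... | inj₁ p = subst (_∈ map (vec n) bs) (vec-toList b) (∈-map⁺ (vec n) p)
    ... | inj₂ p = ⊥-elim (1+n≢n (trans (sym (proj₂ (ts-facts p))) (trans (ones-toList b) eq)))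
    chains-card′ : ∀ {c j} → c ∈ closing n k⁺ ∷ links′ → k⁺ < j → j ≤ suc k⁺ → ∣ c j ∣ ≡ j
    chains-card′ (here refl) p q = ∣closing∣ (sym (+-suc k⁺ k⁺)) p q
    chains-card′ (there c∈)  p q with ∈-map⁻ const-chain c∈
    ... | t , t∈ , refl = trans (∣vec∣ t (proj₁ (ts-facts (there t∈)))) (trans (proj₂ (ts-facts (there t∈))) (sym (squeeze p q)))
    chains-unique′ : ∀ {j} → j ≡ suc k⁺ → Unique (at j (closing n k⁺ ∷ links′))
    chains-unique′ refl = subst Unique (sym at-top) (unique-map-on (vec n)
      (λ x∈ y∈ → vec-injective _ _ (proj₁ (ts-facts x∈)) (proj₁ (ts-facts y∈))) (unique-++ʳ bs all-unique))
    chains-cover′ : ∀ t → ∣ t ∣ ≡ suc k⁺ → t ∈ at (suc k⁺) (closing n k⁺ ∷ links′)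
    chains-cover′ t eq with locate t (inj₂ eq)
    ... | inj₂ p = subst₂ _∈_ (vec-toList t) (sym at-top) (∈-map⁺ (vec n) p)
    ... | inj₁ p = ⊥-elim (1+n≢n (trans (sym eq) (trans (sym (ones-toList t)) (proj₂ (bs-facts p)))))

-- Both smaller instances keep k < l, so the recursion ends at k = 0 or on the middle levels l = k +
-- 1.
saturating : ∀ n k l → n ≡ k + l → k < l → Saturating n k l
saturating n       zero    l       refl k<l = saturating-zero l k<l
saturating (suc n) (suc k) (suc l) eq   (s≤s k<l) with m≤n⇒m<n∨m≡n k<l
... | inj₁ k<l′ = Step.step-saturating n≡ k<l′ (saturating n (suc k) l n≡ k<l′)
        (saturating n k (suc l) (suc-injective eq) (≤-trans (n≤1+n _) (m≤n⇒m≤1+n k<l′)))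
  where
  n≡ : n ≡ suc k + l
  n≡ = trans (suc-injective eq) (+-suc k l)
... | inj₂ refl = subst (λ m → Saturating m (suc k) (suc (suc k))) (sym (trans eq (+-suc (suc k) (suc k))))
        (Middle.middle-saturating k (middle-cycle k))

-- From saturating cycles to Hamilton cycles

module _ {n : ℕ} (c : Subset n) where

  weave : ∀ {a b bs ts} → Walk _⊆_ a b bs ts → List (Subset n)
  weave stop                            = c ∷ []
  weave (step {b′ = b′} {t = t} p q w) = t ∷ b′ ∷ weave w

  weave-↭ : ∀ {a b bs ts} (w : Walk _⊆_ a b bs ts) → a ∷ weave w ↭ bs ++ c ∷ ts
  weave-↭ stop = ↭-refl
  weave-↭ (step {b} {t = t} {bs} {ts} p q w) = ↭-prep b (↭-trans (↭-prep t (weave-↭ w))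
    (↭-trans (↭-sym (shift t bs (c ∷ ts))) (++⁺ˡ-↭ bs (↭-swap t c ↭-refl))))

  weave-path : ∀ {a b bs ts} (w : Walk _⊆_ a b bs ts) → b ⊆ c → Path (a ∷ weave w)
  weave-path stop b⊆c = path-cons _ _ (inj₁ b⊆c) (path-one _)
  weave-path (step p q w) b⊆c = path-cons _ _ (inj₁ p) (path-cons _ _ (inj₂ q) (weave-path w b⊆c))

  weave-last : ∀ {a b bs ts} (w : Walk _⊆_ a b bs ts) x → last x (weave w) ≡ c
  weave-last stop         x = refl
  weave-last (step p q w) x = weave-last w _

  weave-long : ∀ {a b bs ts} (w : Walk _⊆_ a b bs ts) → a ≢ b → 2 ≤ length (weave w)
  weave-long stop         a≢a = ⊥-elim (a≢a refl)
  weave-long (step p q w) _   = s≤s (s≤s z≤n)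

-- The first letters differ. This excludes a walk through one set only, hence a cycle that is too
-- short.
z≢final : ∀ n k → suc k + suc k ≤ n → z (suc n) (suc k) ≢ final (suc n) (suc k)
z≢final n k p rewrite z-pad {k = suc k} p = λ ()

module Hamiltonian {n k l : ℕ} (n≡ : n ≡ suc k + l) (k<l : suc k < l) (S : Saturating n (suc k) l) where

  open Saturating S

  private
    chain-mono : ∀ {c} → c ∈ chains → ∀ j → suc k < j → j ≤ l → c (suc (suc k)) ⊆ c j
    chain-mono c∈ (suc j) (s≤s p) q with m≤n⇒m<n∨m≡n p
    ... | inj₁ p′   = ⊆-trans (chain-mono c∈ j p′ (≤-trans (n≤1+n j) q)) (chains-mono c∈ p′ q)
    ... | inj₂ refl = ⊆-refl

    top-walk : ∀ {a b bs cs} → (∀ {c} → c ∈ cs → c ∈ chains) → Walk (Meets (suc k)) a b bs cs → Walk _⊆_ a b bs (at l cs)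
    top-walk h stop = stop
    top-walk h (step (meets p) (meets q) w) =
      step (⊆-trans p (chain-mono (h (here refl)) l k<l ≤-refl)) (⊆-trans q (chain-mono (h (here refl)) l k<l ≤-refl))
        (top-walk (λ c∈ → h (there c∈)) w)

    w : Walk _⊆_ (z n (suc k)) (final n (suc k)) sets (at l links)
    w = top-walk there walk

    c : Subset n
    c = closing n (suc k) l

    cycle-↭ : z n (suc k) ∷ weave c w ↭ sets ++ at l chains
    cycle-↭ = weave-↭ c w

    2k<n : suc (suc k + suc k) ≤ n
    2k<n = ≤-trans (≤-trans (≤-reflexive (sym (+-suc (suc k) (suc k)))) (+-monoʳ-≤ (suc k) k<l)) (≤-reflexive (sym n≡))

    n∸k : n ∸ suc k ≡ l
    n∸k = trans (cong (_∸ suc k) n≡) (m+n∸m≡n (suc k) l)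

    tops-card : ∀ {t} → t ∈ at l chains → ∣ t ∣ ≡ l
    tops-card t∈ with ∈-map⁻ (λ c → c l) {xs = chains} t∈
    ... | _ , c∈ , refl = chains-card c∈ k<l ≤-refl

    isVertex : ∀ s → s ∈ sets ++ at l chains → IsVertex n (suc k) s
    isVertex s p with ∈-++⁻ sets p
    ... | inj₁ q = inj₁ (sets-card q)
    ... | inj₂ q = inj₂ (trans (tops-card q) (sym n∸k))

    spans : ∀ s → IsVertex n (suc k) s → s ∈ sets ++ at l chains
    spans s (inj₁ eq) = ∈-++⁺ˡ (sets-cover s eq)
    spans s (inj₂ eq) = ∈-++⁺ʳ sets (chains-cover s (trans eq n∸k))

    disjoint : ∀ {s} → ¬ (s ∈ sets × s ∈ at l chains)
    disjoint (p , q) = <⇒≢ k<l (trans (sym (sets-card p)) (tops-card q))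

    start≢end : ∀ m → suc (suc k + suc k) ≤ m → z m (suc k) ≢ final m (suc k)
    start≢end (suc m) (s≤s p) = z≢final m k p

  hamiltonCycle : HamiltonCycle n (suc k)
  hamiltonCycle = record
    { v₀       = z n (suc k)
    ; rest     = weave c w
    ; vertices = λ s s∈ → isVertex s (∈-resp-↭ cycle-↭ s∈)
    ; distinct = Unique-resp-↭ (↭-sym cycle-↭) (Uniq.++⁺ sets-unique (chains-unique k<l ≤-refl) disjoint)
    ; spanning = λ s v → ∈-resp-↭ (↭-sym cycle-↭) (spans s v)
    ; long     = weave-long c w (start≢end n 2k<n)
    ; path     = weave-path c w (⊆-trans (final⊆closing n (suc k) 2k<n) c-above)
    ; closing  = subst (λ x → Adj x (z n (suc k))) (sym (weave-last c w (z n (suc k))))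
        (inj₂ (⊆-trans (z⊆closing n (suc k) 2k<n) c-above))
    }
    where
    c-above : closing n (suc k) (suc (suc k)) ⊆ c
    c-above = chain-mono {closing n (suc k)} (here refl) l k<l ≤-refl

theorem10 : (n k : ℕ) → 1 ≤ k → 2 * k + 1 ≤ n → HamiltonCycle n k
theorem10 n (suc k) _ 2k+1≤n = Hamiltonian.hamiltonCycle n≡ k<l (saturating n (suc k) (n ∸ suc k) n≡ k<l)
  where
  k+k<n : suc k + suc (suc k) ≤ n
  k+k<n = ≤-trans (≤-reflexive (trans (+-suc (suc k) (suc k))
    (trans (cong (λ m → suc (suc k + m)) (sym (+-identityʳ (suc k)))) (+-comm 1 (2 * suc k))))) 2k+1≤n
  n≡ : n ≡ suc k + (n ∸ suc k)
  n≡ = sym (m+[n∸m]≡n (≤-trans (m≤m+n (suc k) _) k+k<n))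
  k<l : suc k < n ∸ suc k
  k<l = +-cancelˡ-≤ (suc k) _ _ (≤-trans k+k<n (≤-reflexive n≡))
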